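{- Let $\mathcal{G}$ be a hypergraph with at least one edge. Then $$\gamma(\mathcal{G})\ge 1-\frac{\lambda_{\max}(A_{\mathcal{G}})}{\lambda_{\min}(A_{\mathcal{G}})},$$ where $\lambda_{\max}(A_{\mathcal{G}})$ and $\lambda_{\min}(A_{\mathcal{G}})$ are the largest and smallest eigenvalues of $A_{\mathcal{G}}$.
   Context: A hypergraph $\mathcal{G}=(V,E)$ has a finite vertex set $V$ and a set $E$ of subsets of $V$ (edges), each of cardinality at least $2$. Two distinct vertices are adjacent if some edge contains both. The adjacency matrix $A_{\mathcal{G}}$ has $(A_{\mathcal{G}})_{ij}=\sum_{e\in E,\, i,j\in e}\frac{1}{|e|-1}$ for $i\ne j$ and zero diagonal. The strong chromatic number $\gamma(\mathcal{G})$ is the minimum number of colors in a coloring of the vertices in which any two adjacent vertices get different colors. -}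

module Defs where

open import Algebra.Bundles.Raw using (RawRing)
import Algebra.Definitions.RawMonoid as RawMonoidDefinitions
open import Data.Bool.Base using (if_then_else_)
open import Data.Fin.Base using (Fin)
import Data.Fin.Properties as Fin
open import Data.Fin.Subset using (Subset; _∈_; ∣_∣)
open import Data.Fin.Subset.Properties using (_∈?_)
open import Data.Integer.Base using (+_)
open import Data.List.Base using (List; []; foldr)
open import Data.List.Relation.Unary.All using (All; reduce)
open import Data.List.Relation.Unary.Any using (Any)
open import Data.List.Relation.Unary.Unique.Propositional using (Unique)
open import Data.Nat.Base as ℕ using (ℕ; _∸_)
import Data.Nat.Properties as ℕ
open import Data.Product.Base using (∃; ∃-syntax; _×_; _,_; proj₁; proj₂)
open import Data.Rational.Base as ℚ using (ℚ; 0ℚ; 1ℚ; ½; positive; nonNegative)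
import Data.Rational.Properties as ℚ
open import Data.Rational.Solver using (module +-*-Solver)
open import Data.Sum.Base using (_⊎_; inj₁; inj₂)
open import Data.Vec.Functional using (Vector)
open import Level using (0ℓ)
open import Relation.Binary.PropositionalEquality
open import Relation.Nullary using (¬_; yes; no; does; contradiction)
open import Relation.Nullary.Decidable using (_×-dec_)

abs : ℚ → ℚ
abs = ℚ.∣_∣

------------------------------------------------------------------------
-- Real numbers as Cauchy sequences of rationals, up to _≃_

IsCauchy : (ℕ → ℚ) → Set
IsCauchy s = ∀ ε → 0ℚ ℚ.< ε →
  ∃[ N ] ∀ m n → N ℕ.≤ m → N ℕ.≤ n → ℚ.∣ s m ℚ.- s n ∣ ℚ.< ε

record ℝ : Set where
  constructor mkℝ
  field
    seq    : ℕ → ℚ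
    cauchy : IsCauchy seq

open ℝ public

infix 4 _≃_ _<_ _≤_ _≥_ _#_

_≃_ : ℝ → ℝ → Set
x ≃ y = ∀ ε → 0ℚ ℚ.< ε →
  ∃[ N ] ∀ n → N ℕ.≤ n → ℚ.∣ seq x n ℚ.- seq y n ∣ ℚ.< ε

_<_ : ℝ → ℝ → Set
x < y = ∃[ ε ] 0ℚ ℚ.< ε ×
  ∃[ N ] ∀ n → N ℕ.≤ n → seq x n ℚ.+ ε ℚ.≤ seq y n

_≤_ : ℝ → ℝ → Set
x ≤ y = ¬ (y < x)

_≥_ : ℝ → ℝ → Set
x ≥ y = y ≤ x

-- Apartness: the constructive form of x ≠ y, as needed for division.
_#_ : ℝ → ℝ → Set
x # y = x < y ⊎ y < x

fromℚ : ℚ → ℝ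
fromℚ q = mkℝ (λ _ → q) λ ε 0<ε → 0 , λ _ _ _ _ →
  subst (λ d → ℚ.∣ d ∣ ℚ.< ε) (sym (ℚ.+-inverseʳ q)) 0<ε

fromℕ : ℕ → ℝ
fromℕ n = fromℚ (+ n ℚ./ 1)

0ℝ 1ℝ : ℝ
0ℝ = fromℚ 0ℚ
1ℝ = fromℚ 1ℚ

open +-*-Solver using (solve; _:=_; _:+_; _:*_; _:-_; :-_)

pos-* : ∀ {p q} → 0ℚ ℚ.< p → 0ℚ ℚ.< q → 0ℚ ℚ.< p ℚ.* q
pos-* {p} {q} 0<p 0<q = ℚ.positive⁻¹ (p ℚ.* q)
  {{ℚ.pos*pos⇒pos p {{positive 0<p}} q {{positive 0<q}}}}

*-mono-abs : ∀ p q {b c} → abs p ℚ.≤ b → abs q ℚ.< c → 0ℚ ℚ.< b →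
             abs (p ℚ.* q) ℚ.< b ℚ.* c
*-mono-abs p q {b} {c} p≤b q<c 0<b = begin-strict
  abs (p ℚ.* q)    ≡⟨ ℚ.∣p*q∣≡∣p∣*∣q∣ p q ⟩
  abs p ℚ.* abs q  ≤⟨ ℚ.*-monoʳ-≤-nonNeg (abs q) {{nonNegative (ℚ.0≤∣p∣ q)}} p≤b ⟩
  b ℚ.* abs q      <⟨ ℚ.*-monoʳ-<-pos b {{positive 0<b}} q<c ⟩
  b ℚ.* c          ∎
  where open ℚ.≤-Reasoning

+-cauchy : ∀ x y → IsCauchy (λ n → seq x n ℚ.+ seq y n)
+-cauchy x y ε 0<ε = N₁ ℕ.⊔ N₂ , bound
  where
  δ   = ½ ℚ.* ε
  0<δ = pos-* (ℚ.positive⁻¹ ½) 0<ε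
  N₁  = proj₁ (cauchy x δ 0<δ)
  N₂  = proj₁ (cauchy y δ 0<δ)
  bound : ∀ m n → N₁ ℕ.⊔ N₂ ℕ.≤ m → N₁ ℕ.⊔ N₂ ℕ.≤ n →
          abs ((seq x m ℚ.+ seq y m) ℚ.- (seq x n ℚ.+ seq y n)) ℚ.< ε
  bound m n N≤m N≤n = begin-strict
    abs ((a ℚ.+ b) ℚ.- (c ℚ.+ d))      ≡⟨ cong abs (solve 4 (λ a b c d →
                                            (a :+ b) :- (c :+ d) := (a :- c) :+ (b :- d)) refl a b c d) ⟩
    abs ((a ℚ.- c) ℚ.+ (b ℚ.- d))      ≤⟨ ℚ.∣p+q∣≤∣p∣+∣q∣ (a ℚ.- c) (b ℚ.- d) ⟩
    abs (a ℚ.- c) ℚ.+ abs (b ℚ.- d)    <⟨ ℚ.+-mono-<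
      (proj₂ (cauchy x δ 0<δ) m n (ℕ.m⊔n≤o⇒m≤o N₁ N₂ N≤m) (ℕ.m⊔n≤o⇒m≤o N₁ N₂ N≤n))
      (proj₂ (cauchy y δ 0<δ) m n (ℕ.m⊔n≤o⇒n≤o N₁ N₂ N≤m) (ℕ.m⊔n≤o⇒n≤o N₁ N₂ N≤n)) ⟩
    ½ ℚ.* ε ℚ.+ ½ ℚ.* ε                ≡⟨ ℚ.*-distribʳ-+ ε ½ ½ ⟨
    1ℚ ℚ.* ε                           ≡⟨ ℚ.*-identityˡ ε ⟩
    ε                                  ∎
    where
    open ℚ.≤-Reasoning
    a = seq x m
    b = seq y m
    c = seq x n
    d = seq y n

neg-cauchy : ∀ x → IsCauchy (λ n → ℚ.- seq x n)
neg-cauchy x ε 0<ε = proj₁ (cauchy x ε 0<ε) , λ m n N≤m N≤n →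
  subst (ℚ._< ε) (flip (seq x m) (seq x n)) (proj₂ (cauchy x ε 0<ε) m n N≤m N≤n)
  where
  flip : ∀ a b → abs (a ℚ.- b) ≡ abs (ℚ.- a ℚ.- ℚ.- b)
  flip a b = trans (sym (ℚ.∣-p∣≡∣p∣ (a ℚ.- b)))
    (cong abs (solve 2 (λ a b → :- (a :- b) := :- a :- :- b) refl a b))

bounded : ∀ x → ∃[ B ] 0ℚ ℚ.< B × ∃[ N ] ∀ n → N ℕ.≤ n → abs (seq x n) ℚ.≤ B
bounded x = 1ℚ ℚ.+ abs c , 0<B , N , bound
  where
  0<1 = ℚ.positive⁻¹ 1ℚ
  N   = proj₁ (cauchy x 1ℚ 0<1)
  c   = seq x N
  0<B : 0ℚ ℚ.< 1ℚ ℚ.+ abs c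
  0<B = ℚ.+-mono-<-≤ 0<1 (ℚ.0≤∣p∣ c)
  bound : ∀ n → N ℕ.≤ n → abs (seq x n) ℚ.≤ 1ℚ ℚ.+ abs c
  bound n N≤n = begin
    abs a                      ≡⟨ cong abs (solve 2 (λ a c → a := (a :- c) :+ c) refl a c) ⟩
    abs ((a ℚ.- c) ℚ.+ c)      ≤⟨ ℚ.∣p+q∣≤∣p∣+∣q∣ (a ℚ.- c) c ⟩
    abs (a ℚ.- c) ℚ.+ abs c    ≤⟨ ℚ.+-monoˡ-≤ (abs c)
      (ℚ.<⇒≤ (proj₂ (cauchy x 1ℚ 0<1) n N N≤n ℕ.≤-refl)) ⟩
    1ℚ ℚ.+ abs c               ∎
    where
    open ℚ.≤-Reasoning
    a = seq x n

product-close : ∀ a b c d {B C δ} → 0ℚ ℚ.< B → 0ℚ ℚ.< C →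
                abs a ℚ.≤ B → abs d ℚ.≤ C → abs (a ℚ.- c) ℚ.< δ → abs (b ℚ.- d) ℚ.< δ →
                abs (a ℚ.* b ℚ.- c ℚ.* d) ℚ.< (B ℚ.+ C) ℚ.* δ
product-close a b c d {B} {C} {δ} 0<B 0<C a≤B d≤C a-c<δ b-d<δ = begin-strict
  abs (a ℚ.* b ℚ.- c ℚ.* d)                        ≡⟨ cong abs (solve 4 (λ a b c d →
    a :* b :- c :* d := a :* (b :- d) :+ d :* (a :- c)) refl a b c d) ⟩
  abs (a ℚ.* (b ℚ.- d) ℚ.+ d ℚ.* (a ℚ.- c))        ≤⟨ ℚ.∣p+q∣≤∣p∣+∣q∣ (a ℚ.* (b ℚ.- d)) (d ℚ.* (a ℚ.- c)) ⟩
  abs (a ℚ.* (b ℚ.- d)) ℚ.+ abs (d ℚ.* (a ℚ.- c))  <⟨ ℚ.+-mono-<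
    (*-mono-abs a (b ℚ.- d) a≤B b-d<δ 0<B) (*-mono-abs d (a ℚ.- c) d≤C a-c<δ 0<C) ⟩
  B ℚ.* δ ℚ.+ C ℚ.* δ                              ≡⟨ ℚ.*-distribʳ-+ δ B C ⟨
  (B ℚ.+ C) ℚ.* δ                                  ∎
  where open ℚ.≤-Reasoning

scale : ∀ D ε → 0ℚ ℚ.< D → 0ℚ ℚ.< ε → ∃[ δ ] 0ℚ ℚ.< δ × D ℚ.* δ ≡ ε
scale D ε 0<D 0<ε = ℚ.1/ D ℚ.* ε , pos-* (ℚ.positive⁻¹ (ℚ.1/ D) {{ℚ.1/pos⇒pos D}}) 0<ε , (begin
  D ℚ.* (ℚ.1/ D ℚ.* ε)  ≡⟨ ℚ.*-assoc D (ℚ.1/ D) ε ⟨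
  (D ℚ.* ℚ.1/ D) ℚ.* ε  ≡⟨ cong (ℚ._* ε) (ℚ.*-inverseʳ D) ⟩
  1ℚ ℚ.* ε              ≡⟨ ℚ.*-identityˡ ε ⟩
  ε                     ∎)
  where
  open ≡-Reasoning
  instance
    D⁺ : ℚ.Positive D
    D⁺ = positive 0<D
    D≢0 : ℚ.NonZero D
    D≢0 = ℚ.pos⇒nonZero D

*-cauchy : ∀ x y → IsCauchy (λ n → seq x n ℚ.* seq y n)
*-cauchy x y ε 0<ε =
  let B , 0<B , N₁ , x≤B  = bounded x
      C , 0<C , N₂ , y≤C  = bounded y
      δ , 0<δ , [B+C]δ≡ε = scale (B ℚ.+ C) ε (ℚ.+-mono-< 0<B 0<C) 0<ε
      N₃ , x-close        = cauchy x δ 0<δ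
      N₄ , y-close        = cauchy y δ 0<δ
  in (N₁ ℕ.⊔ N₂) ℕ.⊔ (N₃ ℕ.⊔ N₄) , λ m n N≤m N≤n →
    subst (abs (seq x m ℚ.* seq y m ℚ.- seq x n ℚ.* seq y n) ℚ.<_) [B+C]δ≡ε
      (product-close (seq x m) (seq y m) (seq x n) (seq y n) 0<B 0<C
        (x≤B m (ℕ.m⊔n≤o⇒m≤o N₁ N₂ (ℕ.m⊔n≤o⇒m≤o (N₁ ℕ.⊔ N₂) _ N≤m)))
        (y≤C n (ℕ.m⊔n≤o⇒n≤o N₁ N₂ (ℕ.m⊔n≤o⇒m≤o (N₁ ℕ.⊔ N₂) _ N≤n)))
        (x-close m n (ℕ.m⊔n≤o⇒m≤o N₃ N₄ (ℕ.m⊔n≤o⇒n≤o (N₁ ℕ.⊔ N₂) _ N≤m))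
          (ℕ.m⊔n≤o⇒m≤o N₃ N₄ (ℕ.m⊔n≤o⇒n≤o (N₁ ℕ.⊔ N₂) _ N≤n)))
        (y-close m n (ℕ.m⊔n≤o⇒n≤o N₃ N₄ (ℕ.m⊔n≤o⇒n≤o (N₁ ℕ.⊔ N₂) _ N≤m))
          (ℕ.m⊔n≤o⇒n≤o N₃ N₄ (ℕ.m⊔n≤o⇒n≤o (N₁ ℕ.⊔ N₂) _ N≤n))))

infixl 6 _+_ _-_
infixl 7 _*_
infix  8 -_

_+_ : ℝ → ℝ → ℝ
x + y = mkℝ (λ n → seq x n ℚ.+ seq y n) (+-cauchy x y)

-_ : ℝ → ℝ
- x = mkℝ (λ n → ℚ.- seq x n) (neg-cauchy x)

_-_ : ℝ → ℝ → ℝ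
x - y = x + - y

_*_ : ℝ → ℝ → ℝ
x * y = mkℝ (λ n → seq x n ℚ.* seq y n) (*-cauchy x y)

-- Total reciprocal on ℚ; a sequence apart from 0 has only finitely many
-- zero terms, so the value at 0 does not affect inverse below.
recip : ℚ → ℚ
recip q with q ℚ.≟ 0ℚ
... | yes _   = 0ℚ
... | no  q≢0 = ℚ.1/_ q {{ℚ.≢-nonZero q≢0}}

recip-inverse : ∀ q → q ≢ 0ℚ → q ℚ.* recip q ≡ 1ℚ
recip-inverse q q≢0 with q ℚ.≟ 0ℚ
... | yes q≡0 = contradiction q≡0 q≢0
... | no  ≢0  = ℚ.*-inverseʳ q {{ℚ.≢-nonZero ≢0}}

awayFromZero : ∀ x → x # 0ℝ →
  ∃[ δ ] 0ℚ ℚ.< δ × ∃[ N ] ∀ n → N ℕ.≤ n → δ ℚ.≤ abs (seq x n)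
awayFromZero x (inj₁ (δ , 0<δ , N , x+δ≤0)) = δ , 0<δ , N , λ n N≤n → neg (seq x n) (x+δ≤0 n N≤n)
  where
  neg : ∀ a → a ℚ.+ δ ℚ.≤ 0ℚ → δ ℚ.≤ abs a
  neg a a+δ≤0 = begin
    δ                     ≡⟨ solve 2 (λ a d → d := :- a :+ (a :+ d)) refl a δ ⟩
    ℚ.- a ℚ.+ (a ℚ.+ δ)   ≤⟨ ℚ.+-monoʳ-≤ (ℚ.- a) a+δ≤0 ⟩
    ℚ.- a ℚ.+ 0ℚ          ≡⟨ ℚ.+-identityʳ (ℚ.- a) ⟩
    ℚ.- a                 ≤⟨ p≤∣p∣ (ℚ.- a) ⟩
    abs (ℚ.- a)           ≡⟨ ℚ.∣-p∣≡∣p∣ a ⟩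
    abs a                 ∎
    where
    open ℚ.≤-Reasoning
    p≤∣p∣ : ∀ p → p ℚ.≤ abs p
    p≤∣p∣ p with ℚ.≤-total 0ℚ p
    ... | inj₁ 0≤p = ℚ.≤-reflexive (sym (ℚ.0≤p⇒∣p∣≡p 0≤p))
    ... | inj₂ p≤0 = ℚ.≤-trans p≤0 (ℚ.0≤∣p∣ p)
awayFromZero x (inj₂ (δ , 0<δ , N , δ≤x)) = δ , 0<δ , N , λ n N≤n → pos (seq x n) (δ≤x n N≤n)
  where
  pos : ∀ a → 0ℚ ℚ.+ δ ℚ.≤ a → δ ℚ.≤ abs a
  pos a δ≤a = subst (δ ℚ.≤_) (sym (ℚ.0≤p⇒∣p∣≡p (ℚ.≤-trans (ℚ.<⇒≤ 0<δ) δ≤a′))) δ≤a′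
    where
    δ≤a′ : δ ℚ.≤ a
    δ≤a′ = subst (ℚ._≤ a) (ℚ.+-identityˡ δ) δ≤a

⁻¹-cauchy : ∀ x → x # 0ℝ → IsCauchy (λ n → recip (seq x n))
⁻¹-cauchy x x#0 ε 0<ε with awayFromZero x x#0
... | δ , 0<δ , N₁ , δ≤x = N₁ ℕ.⊔ N₂ , bound
  where
  η   = ε ℚ.* (δ ℚ.* δ)
  0<η = pos-* 0<ε (pos-* 0<δ 0<δ)
  N₂  = proj₁ (cauchy x η 0<η)

  nonzero : ∀ a → δ ℚ.≤ abs a → a ≢ 0ℚ
  nonzero a δ≤a refl = ℚ.<-irrefl refl (ℚ.<-≤-trans 0<δ δ≤a)

  lower : ∀ a b → δ ℚ.≤ abs a → δ ℚ.≤ abs b → δ ℚ.* δ ℚ.≤ abs (a ℚ.* b)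
  lower a b δ≤a δ≤b = begin
    δ ℚ.* δ          ≤⟨ ℚ.*-monoʳ-≤-nonNeg δ {{nonNegative (ℚ.<⇒≤ 0<δ)}} δ≤a ⟩
    abs a ℚ.* δ      ≤⟨ ℚ.*-monoˡ-≤-nonNeg (abs a) {{nonNegative (ℚ.0≤∣p∣ a)}} δ≤b ⟩
    abs a ℚ.* abs b  ≡⟨ ℚ.∣p*q∣≡∣p∣*∣q∣ a b ⟨
    abs (a ℚ.* b)    ∎
    where open ℚ.≤-Reasoning

  difference : ∀ a b → δ ℚ.≤ abs a → δ ℚ.≤ abs b →
               (a ℚ.* b) ℚ.* (recip a ℚ.- recip b) ≡ b ℚ.- a
  difference a b δ≤a δ≤b = begin
    (a ℚ.* b) ℚ.* (r ℚ.- s)                  ≡⟨ solve 4 (λ a b r s →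
      (a :* b) :* (r :- s) := b :* (a :* r) :- a :* (b :* s)) refl a b r s ⟩
    b ℚ.* (a ℚ.* r) ℚ.- a ℚ.* (b ℚ.* s)      ≡⟨ cong₂ (λ u v → b ℚ.* u ℚ.- a ℚ.* v)
      (recip-inverse a (nonzero a δ≤a)) (recip-inverse b (nonzero b δ≤b)) ⟩
    b ℚ.* 1ℚ ℚ.- a ℚ.* 1ℚ                    ≡⟨ cong₂ ℚ._-_ (ℚ.*-identityʳ b) (ℚ.*-identityʳ a) ⟩
    b ℚ.- a                                  ∎
    where
    open ≡-Reasoning
    r = recip a
    s = recip b

  close : ∀ a b → δ ℚ.≤ abs a → δ ℚ.≤ abs b → abs (b ℚ.- a) ℚ.< η →
          abs (recip a ℚ.- recip b) ℚ.< ε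
  close a b δ≤a δ≤b b-a<η = ℚ.*-cancelʳ-<-nonNeg (δ ℚ.* δ) {{nonNegative (ℚ.<⇒≤ (pos-* 0<δ 0<δ))}} (begin-strict
    abs t ℚ.* (δ ℚ.* δ)        ≤⟨ ℚ.*-monoˡ-≤-nonNeg (abs t) {{nonNegative (ℚ.0≤∣p∣ t)}} (lower a b δ≤a δ≤b) ⟩
    abs t ℚ.* abs (a ℚ.* b)    ≡⟨ ℚ.*-comm (abs t) (abs (a ℚ.* b)) ⟩
    abs (a ℚ.* b) ℚ.* abs t    ≡⟨ ℚ.∣p*q∣≡∣p∣*∣q∣ (a ℚ.* b) t ⟨
    abs ((a ℚ.* b) ℚ.* t)      ≡⟨ cong abs (difference a b δ≤a δ≤b) ⟩
    abs (b ℚ.- a)              <⟨ b-a<η ⟩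
    ε ℚ.* (δ ℚ.* δ)            ∎)
    where
    open ℚ.≤-Reasoning
    t = recip a ℚ.- recip b

  bound : ∀ m n → N₁ ℕ.⊔ N₂ ℕ.≤ m → N₁ ℕ.⊔ N₂ ℕ.≤ n →
          abs (recip (seq x m) ℚ.- recip (seq x n)) ℚ.< ε
  bound m n N≤m N≤n = close (seq x m) (seq x n)
    (δ≤x m (ℕ.m⊔n≤o⇒m≤o N₁ N₂ N≤m)) (δ≤x n (ℕ.m⊔n≤o⇒m≤o N₁ N₂ N≤n))
    (proj₂ (cauchy x η 0<η) n m (ℕ.m⊔n≤o⇒n≤o N₁ N₂ N≤n) (ℕ.m⊔n≤o⇒n≤o N₁ N₂ N≤m))

inverse : (x : ℝ) → x # 0ℝ → ℝ
inverse x x#0 = mkℝ (λ n → recip (seq x n)) (⁻¹-cauchy x x#0)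

divide : (x y : ℝ) → y # 0ℝ → ℝ
divide x y y#0 = x * inverse y y#0

ℝ-rawRing : RawRing 0ℓ 0ℓ
ℝ-rawRing = record
  { Carrier = ℝ
  ; _≈_     = _≃_
  ; _+_     = _+_
  ; _*_     = _*_
  ; -_      = -_
  ; 0#      = 0ℝ
  ; 1#      = 1ℝ
  }

open RawMonoidDefinitions (RawRing.+-rawMonoid ℝ-rawRing) public using (sum)

------------------------------------------------------------------------
-- Eigenvalues

Matrix : ℕ → Set
Matrix n = Fin n → Fin n → ℝ

_·_ : ∀ {n} → Matrix n → Vector ℝ n → Vector ℝ n
(M · v) i = sum (λ j → M i j * v j)

IsEigenvalue : ∀ {n} → Matrix n → ℝ → Set
IsEigenvalue M μ =
  ∃[ v ] (∃[ i ] v i # 0ℝ) × (∀ i → (M · v) i ≃ μ * v i)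

IsLargestEigenvalue : ∀ {n} → Matrix n → ℝ → Set
IsLargestEigenvalue M μ = IsEigenvalue M μ × (∀ ν → IsEigenvalue M ν → ν ≤ μ)

IsSmallestEigenvalue : ∀ {n} → Matrix n → ℝ → Set
IsSmallestEigenvalue M μ = IsEigenvalue M μ × (∀ ν → IsEigenvalue M ν → μ ≤ ν)

------------------------------------------------------------------------
-- Hypergraphs

-- The edge set is listed without repetition; no definition below depends
-- on the order of the list.
record Hypergraph (n : ℕ) : Set where
  field
    edges    : List (Subset n)
    distinct : Unique edges
    size≥2   : All (λ e → 2 ℕ.≤ ∣ e ∣) edges

edgeWeight : ∀ {n} (e : Subset n) → 2 ℕ.≤ ∣ e ∣ → ℚ
edgeWeight e 2≤∣e∣ = (+ 1 ℚ./ (∣ e ∣ ∸ 1)) {{ℕ.>-nonZero (ℕ.m<n⇒0<n∸m 2≤∣e∣)}}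

edgeContribution : ∀ {n} → Fin n → Fin n → (e : Subset n) → 2 ℕ.≤ ∣ e ∣ → ℚ
edgeContribution i j e 2≤∣e∣ =
  if does (i ∈? e ×-dec j ∈? e) then edgeWeight e 2≤∣e∣ else 0ℚ

module _ {n : ℕ} (G : Hypergraph n) where
  open Hypergraph G

  HasEdge : Set
  HasEdge = edges ≢ []

  Adjacent : Fin n → Fin n → Set
  Adjacent i j = i ≢ j × Any (λ e → i ∈ e × j ∈ e) edges

  IsStrongColoring : ∀ {k} → (Fin n → Fin k) → Set
  IsStrongColoring c = ∀ i j → Adjacent i j → c i ≢ c j

  StronglyColorable : ℕ → Set
  StronglyColorable k = ∃ λ (c : Fin n → Fin k) → IsStrongColoring c

  IsStrongChromaticNumber : ℕ → Set
  IsStrongChromaticNumber γ =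
    StronglyColorable γ × (∀ k → StronglyColorable k → γ ℕ.≤ k)

  adjacencyEntry : Fin n → Fin n → ℚ
  adjacencyEntry i j with i Fin.≟ j
  ... | yes _ = 0ℚ
  ... | no  _ = foldr ℚ._+_ 0ℚ (reduce (λ {e} → edgeContribution i j e) size≥2)

  adjacencyMatrix : Matrix n
  adjacencyMatrix i j = fromℚ (adjacencyEntry i j)

{-# OPTIONS --safe #-}

-- Hoffman's bound. If A - q I is positive semidefinite and c is a proper
-- colouring with N colours, then summing the quadratic form of A - q I over
-- the vectors i ↦ (N [c i = d] - 1) xᵢ, d a colour, shows that
-- (1 - N) q I - A is positive semidefinite too; an eigenvector for λmax then
-- gives λmax ≤ (1 - N) q.  It remains to see that q = λmin is admissible.
-- Schur complements decide whether A - q I is positive semidefinite for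
-- rational q, so bisection yields the infimum μ of the Rayleigh quotient as a
-- Cauchy real.  A - μ I is positive semidefinite but not definite, and
-- elimination over ℝ, with signs known only up to double negation, gives it a
-- kernel vector.  So it is not false that μ is an eigenvalue, whence λmin ≤ μ.
-- Finally μ ≤ -Aᵢⱼ/2 < 0 for adjacent i and j, by testing with eᵢ - eⱼ.

module Submission where

open import Algebra.Bundles using (CommutativeRing)
import Algebra.Properties.Ring as RingProperties
import Algebra.Properties.Semiring.Sum as SemiringSum
import Algebra.Solver.Ring as RingSolver
open import Algebra.Solver.Ring.AlmostCommutativeRing using (_-Raw-AlmostCommutative⟶_; fromCommutativeRing)
open import Algebra.Structures using (IsCommutativeRing)
open import Data.Bool.Base using (if_then_else_)
open import Data.Empty using (⊥; ⊥-elim)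
open import Data.Fin.Base using (Fin; zero; suc)
import Data.Fin.Properties as Fin
open import Data.Fin.Subset using (Subset; _∈_; ∣_∣; inside; outside)
open import Data.Fin.Subset.Properties using (_∈?_)
open import Data.Integer.Base as ℤ using (+_)
import Data.Integer.Properties as ℤ
open import Data.List.Base using ([]; foldr)
open import Data.List.Relation.Unary.All using (All; []; reduce)
open import Data.List.Relation.Unary.Any using (Any; here; there)
open import Data.Maybe.Base using (Maybe; just; nothing)
open import Data.Nat.Base as ℕ using (ℕ; zero; suc)
import Data.Nat.Coprimality as Coprimality
import Data.Nat.Properties as ℕ
open import Data.Product.Base using (∃-syntax; Σ-syntax; _×_; _,_)
open import Data.Rational.Base as ℚ using (ℚ; mkℚ; 0ℚ; 1ℚ; ½)
import Data.Rational.Properties as ℚ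
open import Data.Rational.Solver using (module +-*-Solver)
open import Data.Sum.Base using (_⊎_; inj₁; inj₂)
import Data.Vec.Base as Vec
open import Data.Vec.Functional using (Vector; _∷_; head; tail)
open import Effect.Monad using (RawMonad)
open import Function.Base using (_∘_)
import Function.Identity.Effectful as Identity
open import Level using (0ℓ)
open import Relation.Binary.Definitions using (tri<; tri≈; tri>)
import Relation.Binary.PropositionalEquality as ≡
open import Relation.Binary.PropositionalEquality using (_≡_; _≢_)
open import Relation.Nullary using (¬_; yes; no; does)
open import Relation.Nullary.Decidable using (dec-true; dec-false)
open import Relation.Nullary.Negation using (DoubleNegation; ¬¬-Monad; contradiction)

-- Quadratic forms over ordered algebras

-- The hypotheses give `λmin` only as the least eigenvalue; that `A - λmin I` is positive
-- semidefinite is a piece of the spectral theorem, whose usual proof picks a minimising vector by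
-- compactness and is not constructive. The order saves the argument: `≤` is a negated `<`, so
-- `λmin ≤ μ` follows already from the double negation of `IsEigenvalue`. The one positive datum to
-- be produced, `λmin # 0ℝ`, comes from the explicit rational margin between `μ` and 0. Two choices
-- let a single elimination serve both ℚ, where it decides, and ℝ, where it only refutes. Schur
-- complements are multiplied by the pivot, so nothing is ever divided. And definiteness is recorded
-- as a uniform inequality `c |x|² ≤ k Q(x)` with `c > 0`: positivity of `Q` at each single vector
-- would not contradict an infimum equal to zero, while the uniform inequality fails at a rational
-- vector taken from a narrow enough bracket.

-- The sign of an element is only known inside the monad T, which is the
-- identity for ℚ and double negation for ℝ.
record OrderedAlgebra (T : Set → Set) : Set₁ where
  field
    monad           : RawMonad T
    run             : T ⊥ → ⊥
    commutativeRing : CommutativeRing 0ℓ 0ℓ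
  open CommutativeRing commutativeRing public
  field
    ι         : ℚ.+-*-rawRing -Raw-AlmostCommutative⟶ fromCommutativeRing commutativeRing
    Pos       : Carrier → Set
    Pos-resp  : ∀ {x y} → x ≈ y → Pos x → Pos y
    Pos-+     : ∀ {x y} → Pos x → Pos y → Pos (x + y)
    Pos-*     : ∀ {x y} → Pos x → Pos y → Pos (x * y)
    Pos-1     : Pos 1#
    ¬Pos-0    : ¬ Pos 0#
    compare   : ∀ x → T (Pos x ⊎ x ≈ 0# ⊎ Pos (- x))

module QuadraticForms {T : Set → Set} (K : OrderedAlgebra T) where
  open OrderedAlgebra K hiding (zero)
  open RawMonad monad using (pure; _>>=_)
  open SemiringSum semiring public
  open RingProperties ring using (-0#≈0#)
  open import Relation.Binary.Reasoning.Setoid setoid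
  open _-Raw-AlmostCommutative⟶_ ι using (⟦_⟧; 0-homo; 1-homo)

  coefficientsEqual : ∀ p q → Maybe (⟦ p ⟧ ≈ ⟦ q ⟧)
  coefficientsEqual p q with p ℚ.≟ q
  ... | yes p≡q = just (reflexive (≡.cong ⟦_⟧ p≡q))
  ... | no _    = nothing

  open RingSolver ℚ.+-*-rawRing (fromCommutativeRing commutativeRing) ι coefficientsEqual public
    using (solve; _:=_; _:+_; _:*_; _:-_; :-_; con)

  neg-difference : ∀ x y → - (y + - x) ≈ x + - y
  neg-difference = solve 2 (λ x y → :- (y :+ :- x) := x :+ :- y) refl

  -- With `v` for `1/q` this is `(1 - p/q - n)(-q) = -(q - nq - p)`. For negative `q` it turns a
  -- strict violation of the quotient bound into a violation of its division-free form.
  quotient-identity : ∀ n p {q v} → v * q ≈ 1# → ((1# + - (p * v)) + - n) * - q ≈ - ((q + - (n * q)) + - p)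
  quotient-identity n p {q} {v} vq≈1 = begin
    ((1# + - (p * v)) + - n) * - q      ≈⟨ *-congʳ (+-congʳ (+-congʳ 1-homo)) ⟨
    ((⟦ 1ℚ ⟧ + - (p * v)) + - n) * - q
      ≈⟨ solve 4 (λ n p q v → ((con 1ℚ :+ :- (p :* v)) :+ :- n) :* :- q := (:- q :+ n :* q) :+ p :* (v :* q))
           refl n p q v ⟩
    (- q + n * q) + p * (v * q)         ≈⟨ +-congˡ (*-congˡ (trans vq≈1 (sym 1-homo))) ⟩
    (- q + n * q) + p * ⟦ 1ℚ ⟧
      ≈⟨ solve 3 (λ n p q → (:- q :+ n :* q) :+ p :* con 1ℚ := :- ((q :+ :- (n :* q)) :+ :- p)) refl n p q ⟩
    - ((q + - (n * q)) + - p)           ∎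

  NonNeg : Carrier → Set
  NonNeg x = ¬ Pos (- x)

  NonNeg-resp : ∀ {x y} → x ≈ y → NonNeg x → NonNeg y
  NonNeg-resp x≈y x≥0 -y>0 = x≥0 (Pos-resp (-‿cong (sym x≈y)) -y>0)

  Pos⇒NonNeg : ∀ {x} → Pos x → NonNeg x
  Pos⇒NonNeg {x} x>0 -x>0 = ¬Pos-0 (Pos-resp (-‿inverseʳ x) (Pos-+ x>0 -x>0))

  0-nonNeg : NonNeg 0#
  0-nonNeg -0>0 = ¬Pos-0 (Pos-resp -0#≈0# -0>0)

  -- A weak inequality is a negation, hence it escapes from `T`: proofs of `NonNeg` may distinguish
  -- cases by signs that are not decidable.
  NonNeg-intro : ∀ {x} → T (NonNeg x) → NonNeg x
  NonNeg-intro t -x>0 = run (t >>= λ x≥0 → ⊥-elim (x≥0 -x>0))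

  NonNeg-split : ∀ {x} → NonNeg x → T (Pos x ⊎ x ≈ 0#)
  NonNeg-split {x} x≥0 = compare x >>= λ where
    (inj₁ x>0)         → pure (inj₁ x>0)
    (inj₂ (inj₁ x≈0))  → pure (inj₂ x≈0)
    (inj₂ (inj₂ -x>0)) → ⊥-elim (x≥0 -x>0)

  NonNeg-+ : ∀ {x y} → NonNeg x → NonNeg y → NonNeg (x + y)
  NonNeg-+ {x} {y} x≥0 y≥0 = NonNeg-intro (NonNeg-split x≥0 >>= λ where
    (inj₂ x≈0) → pure (NonNeg-resp (sym (trans (+-congʳ x≈0) (+-identityˡ y))) y≥0)
    (inj₁ x>0) → NonNeg-split y≥0 >>= λ where
      (inj₁ y>0) → pure (Pos⇒NonNeg (Pos-+ x>0 y>0))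
      (inj₂ y≈0) → pure (NonNeg-resp (sym (trans (+-congˡ y≈0) (+-identityʳ x))) x≥0))

  NonNeg-* : ∀ {x y} → NonNeg x → NonNeg y → NonNeg (x * y)
  NonNeg-* {x} {y} x≥0 y≥0 = NonNeg-intro (NonNeg-split x≥0 >>= λ where
    (inj₂ x≈0) → pure (NonNeg-resp (sym (trans (*-congʳ x≈0) (zeroˡ y))) 0-nonNeg)
    (inj₁ x>0) → NonNeg-split y≥0 >>= λ where
      (inj₁ y>0) → pure (Pos⇒NonNeg (Pos-* x>0 y>0))
      (inj₂ y≈0) → pure (NonNeg-resp (sym (trans (*-congˡ y≈0) (zeroʳ x))) 0-nonNeg))

  square-nonNeg : ∀ x → NonNeg (x * x)
  square-nonNeg x = NonNeg-intro (compare x >>= λ where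
    (inj₁ x>0)         → pure (Pos⇒NonNeg (Pos-* x>0 x>0))
    (inj₂ (inj₁ x≈0))  → pure (NonNeg-resp (sym (trans (*-congʳ x≈0) (zeroˡ x))) 0-nonNeg)
    (inj₂ (inj₂ -x>0)) → pure (NonNeg-resp (solve 1 (λ x → :- x :* :- x := x :* x) refl x)
                                           (Pos⇒NonNeg (Pos-* -x>0 -x>0))))

  NonNeg-cancel : ∀ {a x} → Pos a → NonNeg (a * x) → NonNeg x
  NonNeg-cancel {a} {x} a>0 ax≥0 -x>0 =
    ax≥0 (Pos-resp (solve 2 (λ a x → a :* :- x := :- (a :* x)) refl a x) (Pos-* a>0 -x>0))

  sum-nonNeg : ∀ {n} (x : Vector Carrier n) → (∀ i → NonNeg (x i)) → NonNeg (sum x)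
  sum-nonNeg {zero}  x x≥0 = 0-nonNeg
  sum-nonNeg {suc n} x x≥0 = NonNeg-+ (x≥0 zero) (sum-nonNeg (x ∘ suc) (x≥0 ∘ suc))

  sum-linear : ∀ {n} a c (x y : Vector Carrier n) →
               sum (λ i → a * x i + c * y i) ≈ a * sum x + c * sum y
  sum-linear a c x y = trans (∑-distrib-+ (λ i → a * x i) (λ i → c * y i))
    (+-cong (sym (*-distribˡ-sum a x)) (sym (*-distribˡ-sum c y)))

  sum-zero : ∀ {n} (x : Vector Carrier n) → (∀ i → x i ≈ 0#) → sum x ≈ 0#
  sum-zero {n} x x≈0 = trans (sum-cong-≋ x≈0) (sum-replicate-zero n)

  -- Dot products and the quadratic form of a matrix.

  dot : ∀ {n} → Vector Carrier n → Vector Carrier n → Carrier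
  dot x y = sum λ i → x i * y i

  SquareMatrix : ℕ → Set
  SquareMatrix n = Fin n → Fin n → Carrier

  apply : ∀ {n} → SquareMatrix n → Vector Carrier n → Vector Carrier n
  apply M x i = dot (M i) x

  Q : ∀ {n} → SquareMatrix n → Vector Carrier n → Carrier
  Q M x = dot x (apply M x)

  δ : ∀ {n} → Fin n → Fin n → Carrier
  δ i j = if does (i Fin.≟ j) then 1# else 0#

  Symmetric : ∀ {n} → SquareMatrix n → Set
  Symmetric M = ∀ i j → M i j ≈ M j i

  PSD : ∀ {n} → SquareMatrix n → Set
  PSD M = ∀ x → NonNeg (Q M x)

  NonZero : ∀ {n} → Vector Carrier n → Set
  NonZero x = ∃[ i ] (Pos (x i) ⊎ Pos (- x i))

  norm²-nonNeg : ∀ {n} (x : Vector Carrier n) → NonNeg (dot x x)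
  norm²-nonNeg x = sum-nonNeg _ (λ i → square-nonNeg (x i))

  dot-comm : ∀ {n} (x y : Vector Carrier n) → dot x y ≈ dot y x
  dot-comm x y = sum-cong-≋ (λ i → *-comm (x i) (y i))

  dot-congˡ : ∀ {n} (x : Vector Carrier n) {y z} → (∀ i → y i ≈ z i) → dot x y ≈ dot x z
  dot-congˡ x y≈z = sum-cong-≋ (λ i → *-congˡ (y≈z i))

  dot-linear : ∀ {n} (z : Vector Carrier n) a c x y →
               dot z (λ i → a * x i + c * y i) ≈ a * dot z x + c * dot z y
  dot-linear z a c x y = trans
    (sum-cong-≋ (λ i → solve 5 (λ z a c x y → z :* (a :* x :+ c :* y) := a :* (z :* x) :+ c :* (z :* y))
                         refl (z i) a c (x i) (y i)))
    (sum-linear a c (λ i → z i * x i) (λ i → z i * y i))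

  dot-scale : ∀ {n} (z : Vector Carrier n) a x → dot z (λ i → a * x i) ≈ a * dot z x
  dot-scale z a x = trans
    (sum-cong-≋ (λ i → solve 3 (λ z a x → z :* (a :* x) := a :* (z :* x)) refl (z i) a (x i)))
    (sym (*-distribˡ-sum a (λ i → z i * x i)))

  dot-δ : ∀ {n} (z : Vector Carrier n) i → dot z (δ i) ≈ z i
  dot-δ z zero = begin
    z zero * 1# + sum (λ i → z (suc i) * 0#)  ≈⟨ +-cong (*-identityʳ _) (sum-zero _ (λ i → zeroʳ (z (suc i)))) ⟩
    z zero + 0#                               ≈⟨ +-identityʳ _ ⟩
    z zero                                    ∎
  dot-δ z (suc i) = begin
    z zero * 0# + dot (z ∘ suc) (δ i)  ≈⟨ +-cong (zeroʳ _) (dot-δ (z ∘ suc) i) ⟩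
    0# + z (suc i)                     ≈⟨ +-identityˡ _ ⟩
    z (suc i)                          ∎

  Q-scale : ∀ {n} (M : SquareMatrix n) a x → Q M (λ i → a * x i) ≈ a * a * Q M x
  Q-scale M a x = begin
    dot (λ i → a * x i) (apply M (λ i → a * x i))  ≈⟨ dot-congˡ (λ i → a * x i) (λ i → dot-scale (M i) a x) ⟩
    dot (λ i → a * x i) (λ i → a * apply M x i)    ≈⟨ dot-scale (λ i → a * x i) a (apply M x) ⟩
    a * dot (λ i → a * x i) (apply M x)            ≈⟨ *-congˡ (dot-comm (λ i → a * x i) (apply M x)) ⟩
    a * dot (apply M x) (λ i → a * x i)            ≈⟨ *-congˡ (dot-scale (apply M x) a x) ⟩
    a * (a * dot (apply M x) x)                    ≈⟨ *-congˡ (*-congˡ (dot-comm (apply M x) x)) ⟩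
    a * (a * Q M x)                                ≈⟨ *-assoc a a (Q M x) ⟨
    a * a * Q M x                                  ∎

  Q-δ : ∀ {n} (M : SquareMatrix n) i → Q M (δ i) ≈ M i i
  Q-δ M i = begin
    dot (δ i) (apply M (δ i))  ≈⟨ dot-comm (δ i) (apply M (δ i)) ⟩
    dot (apply M (δ i)) (δ i)  ≈⟨ dot-δ (apply M (δ i)) i ⟩
    dot (M i) (δ i)            ≈⟨ dot-δ (M i) i ⟩
    M i i                      ∎

  -- Splitting off the first coordinate.

  minor : ∀ {n} → SquareMatrix (suc n) → SquareMatrix n
  minor M i j = M (suc i) (suc j)

  Q-split : ∀ {n} (M : SquareMatrix (suc n)) → Symmetric M → ∀ x →
            Q M x ≈ M zero zero * (head x * head x)
                    + (head x * dot (tail (M zero)) (tail x) + head x * dot (tail (M zero)) (tail x))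
                    + Q (minor M) (tail x)
  Q-split M M-sym x = begin
    x₀ * (a * x₀ + β) + sum (λ i → x′ i * (M (suc i) zero * x₀ + apply D x′ i))
      ≈⟨ +-congˡ (sum-cong-≋ λ i → trans (*-congˡ (+-congʳ (*-congʳ (M-sym (suc i) zero))))
           (solve 4 (λ x b x₀ y → x :* (b :* x₀ :+ y) := x₀ :* (b :* x) :+ con 1ℚ :* (x :* y))
              refl (x′ i) (b i) x₀ (apply D x′ i))) ⟩
    x₀ * (a * x₀ + β) + sum (λ i → x₀ * (b i * x′ i) + ⟦ 1ℚ ⟧ * (x′ i * apply D x′ i))
      ≈⟨ +-congˡ (sum-linear x₀ ⟦ 1ℚ ⟧ (λ i → b i * x′ i) (λ i → x′ i * apply D x′ i)) ⟩
    x₀ * (a * x₀ + β) + (x₀ * β + ⟦ 1ℚ ⟧ * Q D x′)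
      ≈⟨ solve 4 (λ x₀ a β q → x₀ :* (a :* x₀ :+ β) :+ (x₀ :* β :+ con 1ℚ :* q)
                    := a :* (x₀ :* x₀) :+ (x₀ :* β :+ x₀ :* β) :+ q) refl x₀ a β (Q D x′) ⟩
    a * (x₀ * x₀) + (x₀ * β + x₀ * β) + Q D x′ ∎
    where
    a = M zero zero
    b = tail (M zero)
    D = minor M
    x₀ = head x
    x′ = tail x
    β = dot b x′

  -- The Schur complement of the top left entry a, multiplied by a.
  schur : ∀ {n} → SquareMatrix (suc n) → SquareMatrix n
  schur M i j = M zero zero * M (suc i) (suc j) + - M zero (suc i) * M zero (suc j)

  schur-sym : ∀ {n} {M : SquareMatrix (suc n)} → Symmetric M → Symmetric (schur M)
  schur-sym {M = M} M-sym i j = +-cong (*-congˡ (M-sym (suc i) (suc j)))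
    (solve 2 (λ x y → :- x :* y := :- y :* x) refl (M zero (suc i)) (M zero (suc j)))

  apply-schur : ∀ {n} (M : SquareMatrix (suc n)) x i →
                apply (schur M) x i ≈ M zero zero * apply (minor M) x i
                                      + - M zero (suc i) * dot (tail (M zero)) x
  apply-schur M x i = begin
    dot (schur M i) x  ≈⟨ dot-comm (schur M i) x ⟩
    dot x (schur M i)  ≈⟨ dot-linear x a (- b i) (minor M i) b ⟩
    a * dot x (minor M i) + - b i * dot x b
      ≈⟨ +-cong (*-congˡ (dot-comm x (minor M i))) (*-congˡ (dot-comm x b)) ⟩
    a * apply (minor M) x i + - b i * dot b x ∎
    where
    a = M zero zero
    b = tail (M zero)

  Q-schur : ∀ {n} (M : SquareMatrix (suc n)) x →
            Q (schur M) x ≈ M zero zero * Q (minor M) x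
                            + - (dot (tail (M zero)) x * dot (tail (M zero)) x)
  Q-schur M x = begin
    dot x (apply (schur M) x)
      ≈⟨ dot-congˡ x (λ i → trans (apply-schur M x i)
           (+-congˡ (solve 2 (λ b β → :- b :* β := :- β :* b) refl (b i) β))) ⟩
    dot x (λ i → a * apply (minor M) x i + - β * b i)
      ≈⟨ dot-linear x a (- β) (apply (minor M) x) b ⟩
    a * Q (minor M) x + - β * dot x b
      ≈⟨ +-congˡ (trans (*-congˡ (dot-comm x b)) (solve 1 (λ β → :- β :* β := :- (β :* β)) refl β)) ⟩
    a * Q (minor M) x + - (β * β) ∎
    where
    a = M zero zero
    b = tail (M zero)
    β = dot b x

  completeSquare : ∀ {n} (M : SquareMatrix (suc n)) → Symmetric M → ∀ x →
    let u = M zero zero * head x + dot (tail (M zero)) (tail x) in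
    M zero zero * Q M x ≈ u * u + Q (schur M) (tail x)
  completeSquare M M-sym x = begin
    a * Q M x  ≈⟨ *-congˡ (Q-split M M-sym x) ⟩
    a * (a * (x₀ * x₀) + (x₀ * β + x₀ * β) + q)
      ≈⟨ solve 4 (λ a x β q → a :* (a :* (x :* x) :+ (x :* β :+ x :* β) :+ q)
           := (a :* x :+ β) :* (a :* x :+ β) :+ (a :* q :+ :- (β :* β))) refl a x₀ β q ⟩
    u * u + (a * q + - (β * β))  ≈⟨ +-congˡ (Q-schur M (tail x)) ⟨
    u * u + Q (schur M) (tail x) ∎
    where
    a = M zero zero
    x₀ = head x
    β = dot (tail (M zero)) (tail x)
    q = Q (minor M) (tail x)
    u = a * x₀ + β

  -- The extension of `x` that makes the square in `completeSquare` vanish, scaled by the pivot to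
  -- avoid dividing. It carries negative vectors and kernel vectors of the Schur complement back to
  -- `M`.
  lift : ∀ {n} → SquareMatrix (suc n) → Vector Carrier n → Vector Carrier (suc n)
  lift M x = - dot (tail (M zero)) x ∷ λ i → M zero zero * x i

  Q-lift : ∀ {n} (M : SquareMatrix (suc n)) → Symmetric M → ∀ x →
           Q M (lift M x) ≈ M zero zero * Q (schur M) x
  Q-lift M M-sym x = begin
    Q M (lift M x)  ≈⟨ Q-split M M-sym (lift M x) ⟩
    a * (- β * - β) + (- β * dot b (λ i → a * x i) + - β * dot b (λ i → a * x i)) + Q (minor M) (λ i → a * x i)
      ≈⟨ +-cong (+-congˡ (+-cong (*-congˡ (dot-scale b a x)) (*-congˡ (dot-scale b a x)))) (Q-scale (minor M) a x) ⟩
    a * (- β * - β) + (- β * (a * β) + - β * (a * β)) + a * a * q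
      ≈⟨ solve 3 (λ a β q → a :* (:- β :* :- β) :+ (:- β :* (a :* β) :+ :- β :* (a :* β)) :+ a :* a :* q
           := a :* (a :* q :+ :- (β :* β))) refl a β q ⟩
    a * (a * q + - (β * β))  ≈⟨ *-congˡ (Q-schur M x) ⟨
    a * Q (schur M) x ∎
    where
    a = M zero zero
    b = tail (M zero)
    β = dot b x
    q = Q (minor M) x

  kernel-lift : ∀ {n} (M : SquareMatrix (suc n)) → Symmetric M → ∀ x →
                (∀ i → apply (schur M) x i ≈ 0#) → ∀ i → apply M (lift M x) i ≈ 0#
  kernel-lift M M-sym x kx zero = begin
    a * - β + dot b (λ i → a * x i)  ≈⟨ +-congˡ (dot-scale b a x) ⟩
    a * - β + a * β                  ≈⟨ solve 2 (λ a β → a :* :- β :+ a :* β := con 0ℚ) refl a β ⟩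
    ⟦ 0ℚ ⟧                           ≈⟨ 0-homo ⟩
    0#                               ∎
    where
    a = M zero zero
    b = tail (M zero)
    β = dot b x
  kernel-lift M M-sym x kx (suc i) = begin
    M (suc i) zero * - β + dot (minor M i) (λ i → a * x i)
      ≈⟨ +-cong (*-congʳ (M-sym (suc i) zero)) (dot-scale (minor M i) a x) ⟩
    M zero (suc i) * - β + a * apply (minor M) x i
      ≈⟨ solve 4 (λ b β a y → b :* :- β :+ a :* y := a :* y :+ :- b :* β) refl (M zero (suc i)) β a (apply (minor M) x i) ⟩
    a * apply (minor M) x i + - M zero (suc i) * β  ≈⟨ apply-schur M x i ⟨
    apply (schur M) x i                             ≈⟨ kx i ⟩
    0# ∎
    where
    a = M zero zero
    β = dot (tail (M zero)) x

  -- Explicit bounds for linear and quadratic forms.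

  -- A Cauchy-Schwarz inequality with a lossy constant: `(u + v)² ≤ 2u² + 2v²`, applied one
  -- coordinate at a time.
  dot-bounded : ∀ {n} (b : Vector Carrier n) →
                ∃[ c ] NonNeg c × ∀ x → NonNeg (c * dot x x + - (dot b x * dot b x))
  dot-bounded {zero}  b = 0# , 0-nonNeg , λ x → NonNeg-resp (sym (-‿inverseʳ (0# * 0#))) 0-nonNeg
  dot-bounded {suc n} b with dot-bounded (b ∘ suc)
  ... | c , c≥0 , bound = (b₀ * b₀ + b₀ * b₀) + (c + c)
                        , NonNeg-+ (NonNeg-+ (square-nonNeg b₀) (square-nonNeg b₀)) (NonNeg-+ c≥0 c≥0)
                        , bound′
    where
    b₀ = head b
    bound′ : ∀ x → NonNeg (((b₀ * b₀ + b₀ * b₀) + (c + c)) * dot x x + - (dot b x * dot b x))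
    bound′ x = NonNeg-resp
      (solve 5 (λ b c x s β →
          (b :* x :- β) :* (b :* x :- β) :+ (b :* b :* s :+ b :* b :* s) :+ (c :* (x :* x) :+ c :* (x :* x))
            :+ ((c :* s :+ :- (β :* β)) :+ (c :* s :+ :- (β :* β)))
          := ((b :* b :+ b :* b) :+ (c :+ c)) :* (x :* x :+ s) :+ :- ((b :* x :+ β) :* (b :* x :+ β)))
        refl b₀ c x₀ (dot x′ x′) (dot (tail b) x′))
      (NonNeg-+ (NonNeg-+ (NonNeg-+ (square-nonNeg _) (NonNeg-+ b²s≥0 b²s≥0)) (NonNeg-+ cx²≥0 cx²≥0))
                (NonNeg-+ (bound x′) (bound x′)))
      where
      x₀ = head x
      x′ = tail x
      b²s≥0 = NonNeg-* (square-nonNeg b₀) (norm²-nonNeg x′)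
      cx²≥0 = NonNeg-* c≥0 (square-nonNeg x₀)

  -- Supplies `-c` as the first lower end of the bisection.
  Q-bounded-below : ∀ {n} (M : SquareMatrix n) → Symmetric M →
                    ∃[ c ] NonNeg c × ∀ x → NonNeg (Q M x + c * dot x x)
  Q-bounded-below {zero}  M M-sym = 0# , 0-nonNeg , λ x →
    NonNeg-+ 0-nonNeg (NonNeg-* 0-nonNeg 0-nonNeg)
  Q-bounded-below {suc n} M M-sym
    with dot-bounded (tail (M zero)) | Q-bounded-below (minor M) (λ i j → M-sym (suc i) (suc j))
  ... | c , c≥0 , β²≤cs | d , d≥0 , q≥-ds = k , k≥0 , bound
    where
    a = M zero zero
    one = ⟦ 1ℚ ⟧
    half = ⟦ ℚ.½ ⟧
    -- The cross term satisfies `2xβ ≥ -x² - β²`, which costs `1` and `c`; the minor costs `d`. The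
    -- square `(a - 1)²` outweighs a possibly negative `a` without inspecting its sign.
    k = (a + - one) * (a + - one) + one * one + c + d
    k≥0 = NonNeg-+ (NonNeg-+ (NonNeg-+ (square-nonNeg _) (square-nonNeg _)) c≥0) d≥0
    -- a + (a - 1)² is the sum of squares ((a + 1)/2)² + 3((a - 1)/2)².
    a+[a-1]²≥0 : NonNeg (a + (a + - one) * (a + - one))
    a+[a-1]²≥0 = NonNeg-resp
      (solve 1 (λ a → (con ℚ.½ :* (a :+ con 1ℚ)) :* (con ℚ.½ :* (a :+ con 1ℚ))
          :+ ((con ℚ.½ :* (a :- con 1ℚ)) :* (con ℚ.½ :* (a :- con 1ℚ))
          :+ (con ℚ.½ :* (a :- con 1ℚ)) :* (con ℚ.½ :* (a :- con 1ℚ))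
          :+ (con ℚ.½ :* (a :- con 1ℚ)) :* (con ℚ.½ :* (a :- con 1ℚ)))
        := a :+ (a :+ :- con 1ℚ) :* (a :+ :- con 1ℚ)) refl a)
      (NonNeg-+ (square-nonNeg (half * (a + one))) (NonNeg-+ (NonNeg-+ t≥0 t≥0) t≥0))
      where t≥0 = square-nonNeg (half * (a + - one))
    bound : ∀ x → NonNeg (Q M x + k * dot x x)
    bound x = NonNeg-resp
      (sym (trans (+-congʳ (Q-split M M-sym x))
        (solve 7 (λ a x β q c d s →
          (a :* (x :* x) :+ (x :* β :+ x :* β) :+ q)
            :+ ((a :+ :- con 1ℚ) :* (a :+ :- con 1ℚ) :+ con 1ℚ :* con 1ℚ :+ c :+ d) :* (x :* x :+ s)
          := (a :+ (a :+ :- con 1ℚ) :* (a :+ :- con 1ℚ)) :* (x :* x) :+ (x :+ β) :* (x :+ β)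
            :+ (c :* s :+ :- (β :* β)) :+ (q :+ d :* s)
            :+ ((a :+ :- con 1ℚ) :* (a :+ :- con 1ℚ) :* s :+ s :+ (c :* (x :* x) :+ d :* (x :* x))))
        refl a x₀ (dot (tail (M zero)) x′) (Q (minor M) x′) c d (dot x′ x′))))
      (NonNeg-+
        (NonNeg-+ (NonNeg-+ (NonNeg-+ (NonNeg-* a+[a-1]²≥0 x₀²≥0) (square-nonNeg _)) (β²≤cs x′)) (q≥-ds x′))
        (NonNeg-+ (NonNeg-+ (NonNeg-* (square-nonNeg _) s≥0) s≥0) (NonNeg-+ (NonNeg-* c≥0 x₀²≥0) (NonNeg-* d≥0 x₀²≥0))))
      where
      x₀ = head x
      x′ = tail x
      x₀²≥0 = square-nonNeg x₀
      s≥0 = norm²-nonNeg x′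

  -- Elimination and its three outcomes.

  -- In `definite` the ratio `c/k` plays the part of a positive lower bound for the Rayleigh
  -- quotient; keeping two constants avoids forming it.
  data Signature {n} (M : SquareMatrix n) : Set where
    negative : ∀ x → Pos (- Q M x) → Signature M
    singular : PSD M → ∀ x → NonZero x → (∀ i → apply M x i ≈ 0#) → Signature M
    definite : PSD M → ∀ c k → Pos c → NonNeg k →
               (∀ x → NonNeg (k * Q M x + - (c * dot x x))) → Signature M

  schur-PSD : ∀ {n} (M : SquareMatrix (suc n)) → Symmetric M → Pos (M zero zero) → PSD (schur M) → PSD M
  schur-PSD M M-sym a>0 psd x = NonNeg-cancel a>0
    (NonNeg-resp (sym (completeSquare M M-sym x)) (NonNeg-+ (square-nonNeg _) (psd (tail x))))

  fromSchur : ∀ {n} (M : SquareMatrix (suc n)) → Symmetric M → Pos (M zero zero) → Signature (schur M) → Signature M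
  fromSchur M M-sym a>0 (negative x Qx<0) = negative (lift M x)
    (Pos-resp (trans (solve 2 (λ a q → a :* :- q := :- (a :* q)) refl (M zero zero) (Q (schur M) x))
                     (-‿cong (sym (Q-lift M M-sym x))))
              (Pos-* a>0 Qx<0))
  fromSchur M M-sym a>0 (singular psd x x≢0 Mx≈0) =
    singular (schur-PSD M M-sym a>0 psd) (lift M x) (lift-nonZero x≢0) (kernel-lift M M-sym x Mx≈0)
    where
    lift-nonZero : NonZero x → NonZero (lift M x)
    lift-nonZero (i , inj₁ xᵢ>0) = suc i , inj₁ (Pos-* a>0 xᵢ>0)
    lift-nonZero (i , inj₂ xᵢ<0) = suc i , inj₂
      (Pos-resp (solve 2 (λ a q → a :* :- q := :- (a :* q)) refl (M zero zero) (x i)) (Pos-* a>0 xᵢ<0))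
  fromSchur M M-sym a>0 (definite psd c k c>0 k≥0 cs≤kQ) with dot-bounded (tail (M zero))
  ... | d , d≥0 , β²≤ds = definite (schur-PSD M M-sym a>0 psd) (c * (a * a)) (k′ * a)
                            (Pos-* c>0 (Pos-* a>0 a>0)) (NonNeg-* k′≥0 (Pos⇒NonNeg a>0)) bound
    where
    a = M zero zero
    -- With `u = a x₀ + β` one has `a² x₀² = (u - β)² ≤ 2u² + 2ds`, so `c a² |x|² ≤ 2c u² + e c s ≤
    -- 2c u² + e k p`. Both terms are at most `k′ (u² + p)`, which is `k′ a Q(x)`.
    e = d + d + a * a
    e≥0 = NonNeg-+ (NonNeg-+ d≥0 d≥0) (square-nonNeg a)
    k′ = (c + c) + e * k
    c≥0 = Pos⇒NonNeg c>0
    k′≥0 = NonNeg-+ (NonNeg-+ c≥0 c≥0) (NonNeg-* e≥0 k≥0)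
    bound : ∀ x → NonNeg (k′ * a * Q M x + - (c * (a * a) * dot x x))
    bound x = NonNeg-resp (begin
      c * ((u + β) * (u + β)) + (c * p + c * p) + e * k * (u * u) + e * (k * p + - (c * s))
        + (c * (d * s + - (β * β)) + c * (d * s + - (β * β)))
        ≈⟨ solve 8 (λ a x β s p c d k →
             c :* ((a :* x :+ β :+ β) :* (a :* x :+ β :+ β)) :+ (c :* p :+ c :* p)
               :+ (d :+ d :+ a :* a) :* k :* ((a :* x :+ β) :* (a :* x :+ β))
               :+ (d :+ d :+ a :* a) :* (k :* p :+ :- (c :* s))
               :+ (c :* (d :* s :+ :- (β :* β)) :+ c :* (d :* s :+ :- (β :* β)))
             := ((c :+ c) :+ (d :+ d :+ a :* a) :* k) :* ((a :* x :+ β) :* (a :* x :+ β) :+ p)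
               :+ :- (c :* (a :* a) :* (x :* x :+ s))) refl a x₀ β s p c d k ⟩
      k′ * (u * u + p) + - (c * (a * a) * dot x x)
        ≈⟨ +-congʳ (trans (*-congˡ (sym (completeSquare M M-sym x))) (sym (*-assoc k′ a (Q M x)))) ⟩
      k′ * a * Q M x + - (c * (a * a) * dot x x) ∎)
      (NonNeg-+ (NonNeg-+ (NonNeg-+ (NonNeg-+
        (NonNeg-* c≥0 (square-nonNeg _)) (NonNeg-+ cp≥0 cp≥0))
        (NonNeg-* (NonNeg-* e≥0 k≥0) (square-nonNeg u)))
        (NonNeg-* e≥0 (cs≤kQ x′)))
        (NonNeg-+ t≥0 t≥0))
      where
      x₀ = head x
      x′ = tail x
      β = dot (tail (M zero)) x′
      u = a * x₀ + β
      s = dot x′ x′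
      p = Q (schur M) x′
      cp≥0 = NonNeg-* c≥0 (psd x′)
      t≥0 = NonNeg-* c≥0 (β²≤ds x′)

  -- A vanishing first row puts the first basis vector into the kernel, so even a definite minor
  -- makes `M` singular.
  fromMinor : ∀ {n} (M : SquareMatrix (suc n)) → Symmetric M → M zero zero ≈ 0# →
              (∀ j → M zero (suc j) ≈ 0#) → Signature (minor M) → Signature M
  fromMinor M M-sym a≈0 b≈0 = λ where
      (negative x Qx<0)        → negative (0# ∷ x) (Pos-resp (-‿cong (sym (Q-minor (0# ∷ x)))) Qx<0)
      (singular psd _ _ _)     → fromPSD psd
      (definite psd _ _ _ _ _) → fromPSD psd
    where
    β≈0 : ∀ x → dot (tail (M zero)) x ≈ 0#
    β≈0 x = sum-zero _ (λ j → trans (*-congʳ (b≈0 j)) (zeroˡ (x j)))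

    Q-minor : ∀ x → Q M x ≈ Q (minor M) (tail x)
    Q-minor x = begin
      Q M x  ≈⟨ Q-split M M-sym x ⟩
      M zero zero * (x₀ * x₀) + (x₀ * β + x₀ * β) + q
        ≈⟨ +-congʳ (+-cong (trans (*-congʳ a≈0) (zeroˡ _)) (+-cong x₀β≈0 x₀β≈0)) ⟩
      0# + (0# + 0#) + q  ≈⟨ +-congʳ (trans (+-identityˡ _) (+-identityˡ _)) ⟩
      0# + q              ≈⟨ +-identityˡ q ⟩
      q                   ∎
      where
      x₀ = head x
      β = dot (tail (M zero)) (tail x)
      q = Q (minor M) (tail x)
      x₀β≈0 = trans (*-congˡ (β≈0 (tail x))) (zeroʳ x₀)

    column≈0 : ∀ i → M i zero ≈ 0#
    column≈0 zero    = a≈0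
    column≈0 (suc i) = trans (M-sym (suc i) zero) (b≈0 i)

    fromPSD : PSD (minor M) → Signature M
    fromPSD psd = singular (λ x → NonNeg-resp (sym (Q-minor x)) (psd (tail x))) (δ zero)
      (zero , inj₁ Pos-1) (λ i → trans (dot-δ (M i) zero) (column≈0 i))

  -- The square is recorded, not the entry, so that both signs of a nonzero entry lead to the same
  -- case.
  nonzeroEntry : ∀ {n} (b : Vector Carrier n) → T ((∃[ j ] Pos (b j * b j)) ⊎ (∀ j → b j ≈ 0#))
  nonzeroEntry {zero}  b = pure (inj₂ λ ())
  nonzeroEntry {suc n} b = compare (b zero) >>= λ where
    (inj₁ b₀>0)         → pure (inj₁ (zero , Pos-* b₀>0 b₀>0))
    (inj₂ (inj₂ b₀<0))  → pure (inj₁ (zero ,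
      Pos-resp (solve 1 (λ x → :- x :* :- x := x :* x) refl (b zero)) (Pos-* b₀<0 b₀<0)))
    (inj₂ (inj₁ b₀≈0))  → nonzeroEntry (b ∘ suc) >>= λ where
      (inj₁ (j , bⱼ²>0)) → pure (inj₁ (suc j , bⱼ²>0))
      (inj₂ b≈0)         → pure (inj₂ λ { zero → b₀≈0 ; (suc j) → b≈0 j })

  -- On the plane of the coordinates 0 and `suc j` the form is `2b x₀ t + y t²`, linear in `x₀` and
  -- so unbounded below. The choice `t = 2b`, `x₀ = -(y + 1)` gives `-4b²` whatever the signs of `b`
  -- and `y`.
  zeroDiagonal : ∀ {n} (M : SquareMatrix (suc n)) → Symmetric M → M zero zero ≈ 0# →
                 ∀ j → Pos (M zero (suc j) * M zero (suc j)) → Signature M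
  zeroDiagonal M M-sym a≈0 j b²>0 = negative x (Pos-resp (-‿cong (sym (begin
      Q M x  ≈⟨ Q-split M M-sym x ⟩
      a * (x₀ * x₀) + (x₀ * β + x₀ * β) + Q (minor M) x′
        ≈⟨ +-cong (+-cong (trans (*-congʳ a≈0) (zeroˡ _)) (+-cong (*-congˡ β≈) (*-congˡ β≈)))
                  (trans (Q-scale (minor M) (b + b) (δ j)) (*-congˡ (Q-δ (minor M) j))) ⟩
      0# + (x₀ * ((b + b) * b) + x₀ * ((b + b) * b)) + (b + b) * (b + b) * y
        ≈⟨ +-congʳ (+-identityˡ _) ⟩
      (x₀ * ((b + b) * b) + x₀ * ((b + b) * b)) + (b + b) * (b + b) * y
        ≈⟨ solve 2 (λ b y → (:- (y :+ con 1ℚ) :* ((b :+ b) :* b) :+ :- (y :+ con 1ℚ) :* ((b :+ b) :* b))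
              :+ (b :+ b) :* (b :+ b) :* y
             := :- ((b :* b :+ b :* b) :+ (b :* b :+ b :* b))) refl b y ⟩
      - ((b * b + b * b) + (b * b + b * b)) ∎)))
    (Pos-resp (solve 1 (λ x → x := :- :- x) refl _) (Pos-+ (Pos-+ b²>0 b²>0) (Pos-+ b²>0 b²>0))))
    where
    a = M zero zero
    b = M zero (suc j)
    y = M (suc j) (suc j)
    x₀ = - (y + ⟦ 1ℚ ⟧)
    x′ = λ i → (b + b) * δ j i
    x = x₀ ∷ x′
    β = dot (tail (M zero)) x′
    β≈ : β ≈ (b + b) * b
    β≈ = trans (dot-scale (tail (M zero)) (b + b) (δ j)) (*-congˡ (dot-δ (tail (M zero)) j))

  signature : ∀ {n} (M : SquareMatrix n) → Symmetric M → T (Signature M)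
  -- In dimension zero `|x|²` is zero, so `c = 1` and `k = 0` will do.
  signature {zero}  M M-sym = pure (definite (λ _ → 0-nonNeg) 1# 0# Pos-1 0-nonNeg λ _ →
    NonNeg-resp (sym (trans (+-cong (zeroˡ _) (-‿cong (zeroʳ 1#))) (-‿inverseʳ 0#))) 0-nonNeg)
  signature {suc n} M M-sym = compare (M zero zero) >>= λ where
    (inj₁ a>0)         → signature (schur M) (schur-sym M-sym) >>= λ s → pure (fromSchur M M-sym a>0 s)
    (inj₂ (inj₂ a<0))  → pure (negative (δ zero) (Pos-resp (-‿cong (sym (Q-δ M zero))) a<0))
    (inj₂ (inj₁ a≈0))  → nonzeroEntry (tail (M zero)) >>= λ where
      (inj₁ (j , b²>0)) → pure (zeroDiagonal M M-sym a≈0 j b²>0)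
      (inj₂ b≈0)        → signature (minor M) (λ i j → M-sym (suc i) (suc j)) >>= λ s →
                          pure (fromMinor M M-sym a≈0 b≈0 s)

  -- The shifted forms `M - q I`.

  δ-sym : ∀ {n} (i j : Fin n) → δ i j ≈ δ j i
  δ-sym zero    zero    = refl
  δ-sym zero    (suc j) = refl
  δ-sym (suc i) zero    = refl
  δ-sym (suc i) (suc j) = δ-sym i j

  shift : ∀ {n} → SquareMatrix n → Carrier → SquareMatrix n
  shift M q i j = M i j + - q * δ i j

  shift-sym : ∀ {n} {M : SquareMatrix n} → Symmetric M → ∀ q → Symmetric (shift M q)
  shift-sym M-sym q i j = +-cong (M-sym i j) (*-congˡ (δ-sym i j))

  apply-shift : ∀ {n} (M : SquareMatrix n) q x i → apply (shift M q) x i ≈ apply M x i + - q * x i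
  apply-shift M q x i = begin
    dot (shift M q i) x                             ≈⟨ dot-comm (shift M q i) x ⟩
    dot x (λ j → M i j + - q * δ i j)               ≈⟨ dot-congˡ x (λ j → +-congʳ (sym (*-identityˡ (M i j)))) ⟩
    dot x (λ j → 1# * M i j + - q * δ i j)          ≈⟨ dot-linear x 1# (- q) (M i) (δ i) ⟩
    1# * dot x (M i) + - q * dot x (δ i)            ≈⟨ +-cong (trans (*-identityˡ _) (dot-comm x (M i))) (*-congˡ (dot-δ x i)) ⟩
    apply M x i + - q * x i                         ∎

  form : ∀ {n} → SquareMatrix n → Carrier → Vector Carrier n → Carrier
  form M q x = Q M x + - q * dot x x

  Q-shift : ∀ {n} (M : SquareMatrix n) q x → Q (shift M q) x ≈ form M q x
  Q-shift M q x = begin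
    dot x (apply (shift M q) x)                     ≈⟨ dot-congˡ x (λ i → trans (apply-shift M q x i) (+-congʳ (sym (*-identityˡ _)))) ⟩
    dot x (λ i → 1# * apply M x i + - q * x i)      ≈⟨ dot-linear x 1# (- q) (apply M x) x ⟩
    1# * Q M x + - q * dot x x                      ≈⟨ +-congʳ (*-identityˡ _) ⟩
    Q M x + - q * dot x x                           ∎

  gap : ∀ {n} → SquareMatrix n → Carrier → Carrier → Carrier → Vector Carrier n → Carrier
  gap M q c k x = k * form M q x + - (c * dot x x)

  -- The signature of `M - q I`, read as the place of `q` relative to the least value of the
  -- Rayleigh quotient.
  data Position {n} (M : SquareMatrix n) (q : Carrier) : Set where
    above  : ∀ x → Pos (- form M q x) → Position M q
    bottom : (∀ x → NonNeg (form M q x)) → ∀ x → NonZero x → (∀ i → apply M x i ≈ q * x i) → Position M q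
    below  : (∀ x → NonNeg (form M q x)) → ∀ c k → Pos c →
             (∀ x → NonNeg (gap M q c k x)) → Position M q

  position : ∀ {n} (M : SquareMatrix n) → Symmetric M → ∀ q → T (Position M q)
  position M M-sym q = signature (shift M q) (shift-sym M-sym q) >>= λ where
      (negative x Qx<0)             → pure (above x (Pos-resp (-‿cong (Q-shift M q x)) Qx<0))
      (singular psd x x≢0 Mx≈0)     → pure (bottom (form≥0 psd) x x≢0 (λ i → eigen x i (Mx≈0 i)))
      (definite psd c k c>0 _ cs≤kQ) → pure (below (form≥0 psd) c k c>0
        (λ x → NonNeg-resp (+-congʳ (*-congˡ (Q-shift M q x))) (cs≤kQ x)))
    where
    form≥0 : PSD (shift M q) → ∀ x → NonNeg (form M q x)
    form≥0 psd x = NonNeg-resp (Q-shift M q x) (psd x)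

    eigen : ∀ x i → apply (shift M q) x i ≈ 0# → apply M x i ≈ q * x i
    eigen x i Mx≈0 = begin
      apply M x i                          ≈⟨ solve 3 (λ y q x → y := (y :+ :- q :* x) :+ q :* x) refl (apply M x i) q (x i) ⟩
      (apply M x i + - q * x i) + q * x i  ≈⟨ +-congʳ (trans (sym (apply-shift M q x i)) Mx≈0) ⟩
      0# + q * x i                         ≈⟨ +-identityˡ (q * x i) ⟩
      q * x i                              ∎

  form-antitone : ∀ {n} (M : SquareMatrix n) {q r} → NonNeg (q + - r) →
                  ∀ x → NonNeg (form M q x) → NonNeg (form M r x)
  form-antitone M {q} {r} r≤q x f≥0 = NonNeg-resp
    (solve 4 (λ p q r s → (p :+ :- q :* s) :+ (q :+ :- r) :* s := p :+ :- r :* s) refl (Q M x) q r (dot x x))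
    (NonNeg-+ f≥0 (NonNeg-* r≤q (norm²-nonNeg x)))

  -- The vector `eᵢ - eⱼ`, with `⟦ 1ℚ ⟧` in place of `1#` because the ring solver reads its constant
  -- `con 1ℚ` as `⟦ 1ℚ ⟧`.
  difference : ∀ {n} → Fin n → Fin n → Vector Carrier n
  difference i j k = ⟦ 1ℚ ⟧ * δ i k + - ⟦ 1ℚ ⟧ * δ j k

  form-difference : ∀ {n} (M : SquareMatrix n) → Symmetric M → ∀ {i j} → i ≢ j →
                    M i i ≈ 0# → M j j ≈ 0# → ∀ q →
                    form M q (difference i j) ≈ - (M i j + M i j) + - q * (⟦ 1ℚ ⟧ + ⟦ 1ℚ ⟧)
  form-difference M M-sym {i} {j} i≢j Mii≈0 Mjj≈0 q = +-cong (begin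
      dot y (apply M y)                      ≈⟨ dot-comm y (apply M y) ⟩
      dot (apply M y) y                      ≈⟨ dot-y (apply M y) ⟩
      e * apply M y i + - e * apply M y j    ≈⟨ +-cong (*-congˡ (dot-y (M i))) (*-congˡ (dot-y (M j))) ⟩
      e * (e * M i i + - e * M i j) + - e * (e * M j i + - e * M j j)
        ≈⟨ +-cong (*-congˡ (+-congʳ (*-congˡ (trans Mii≈0 (sym 0-homo)))))
                  (*-congˡ (+-cong (*-congˡ (M-sym j i)) (*-congˡ (trans Mjj≈0 (sym 0-homo))))) ⟩
      e * (e * ⟦ 0ℚ ⟧ + - e * M i j) + - e * (e * M i j + - e * ⟦ 0ℚ ⟧)
        ≈⟨ solve 1 (λ a → con 1ℚ :* (con 1ℚ :* con 0ℚ :+ :- con 1ℚ :* a)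
                            :+ :- con 1ℚ :* (con 1ℚ :* a :+ :- con 1ℚ :* con 0ℚ) := :- (a :+ a)) refl (M i j) ⟩
      - (M i j + M i j) ∎)
    (*-congˡ (begin
      dot y y                                ≈⟨ dot-y y ⟩
      e * (e * δ i i + - e * δ j i) + - e * (e * δ i j + - e * δ j j)
        ≈⟨ +-cong (*-congˡ (+-cong (*-congˡ (δ-same i)) (*-congˡ (δ-distinct (i≢j ∘ ≡.sym)))))
                  (*-congˡ (+-cong (*-congˡ (δ-distinct i≢j)) (*-congˡ (δ-same j)))) ⟩
      e * (e * e + - e * ⟦ 0ℚ ⟧) + - e * (e * ⟦ 0ℚ ⟧ + - e * e)
        ≈⟨ solve 1 (λ a → con 1ℚ :* (con 1ℚ :* con 1ℚ :+ :- con 1ℚ :* con 0ℚ)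
                            :+ :- con 1ℚ :* (con 1ℚ :* con 0ℚ :+ :- con 1ℚ :* con 1ℚ) := con 1ℚ :+ con 1ℚ) refl e ⟩
      e + e ∎))
    where
    e = ⟦ 1ℚ ⟧
    y = difference i j
    dot-y : ∀ z → dot z y ≈ e * z i + - e * z j
    dot-y z = trans (dot-linear z e (- e) (δ i) (δ j)) (+-cong (*-congˡ (dot-δ z i)) (*-congˡ (dot-δ z j)))
    δ-same : ∀ k → δ k k ≈ e
    δ-same k rewrite dec-true (k Fin.≟ k) ≡.refl = sym 1-homo
    δ-distinct : ∀ {k l} → k ≢ l → δ k l ≈ ⟦ 0ℚ ⟧
    δ-distinct {k} {l} k≢l rewrite dec-false (k Fin.≟ l) k≢l = sym 0-homo

  sum-positive : ∀ {n} (x : Vector Carrier n) → (∀ i → NonNeg (x i)) → ∀ i → Pos (x i) → T (Pos (sum x))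
  sum-positive x x≥0 zero xᵢ>0 = NonNeg-split (sum-nonNeg (tail x) (x≥0 ∘ suc)) >>= λ where
    (inj₁ Σ>0) → pure (Pos-+ xᵢ>0 Σ>0)
    (inj₂ Σ≈0) → pure (Pos-resp (sym (trans (+-congˡ Σ≈0) (+-identityʳ _))) xᵢ>0)
  sum-positive x x≥0 (suc i) xᵢ>0 = sum-positive (tail x) (x≥0 ∘ suc) i xᵢ>0 >>= λ Σ>0 →
    NonNeg-split (x≥0 zero) >>= λ where
      (inj₁ x₀>0) → pure (Pos-+ x₀>0 Σ>0)
      (inj₂ x₀≈0) → pure (Pos-resp (sym (trans (+-congʳ x₀≈0) (+-identityˡ _))) Σ>0)

  norm²-positive : ∀ {n} (x : Vector Carrier n) → NonZero x → T (Pos (dot x x))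
  norm²-positive x (i , inj₁ xᵢ>0) = sum-positive _ (λ j → square-nonNeg (x j)) i (Pos-* xᵢ>0 xᵢ>0)
  norm²-positive x (i , inj₂ xᵢ<0) = sum-positive _ (λ j → square-nonNeg (x j)) i
    (Pos-resp (solve 1 (λ x → :- x :* :- x := x :* x) refl (x i)) (Pos-* xᵢ<0 xᵢ<0))

  -- Averaging the form over the colours.

  ones : ∀ {n} → Vector Carrier n
  ones _ = ⟦ 1ℚ ⟧

  -- `proper` covers `i = j` as well: `A` vanishes on the whole diagonal block of each colour class.
  -- `N` is the number of colours as a ring element.
  module Hoffman {n g} (A : SquareMatrix n) (c : Fin n → Fin g)
                 (proper : ∀ i j → c i ≡ c j → A i j ≈ 0#)
                 (N : Carrier) (N≈ : dot (ones {g}) ones ≈ N) where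

    -- Row `a` of `N I - J`, with `J` the all-ones matrix: `N` times the projection of a basis
    -- vector to the complement of `ones`. These rows are the vertices of a regular simplex.
    weight : Fin g → Vector Carrier g
    weight a d = N * δ a d + - ⟦ 1ℚ ⟧ * ones d

    dot-weight : ∀ z a → dot z (weight a) ≈ N * z a + - ⟦ 1ℚ ⟧ * dot z ones
    dot-weight z a = trans (dot-linear z N (- ⟦ 1ℚ ⟧) (δ a) ones) (+-congʳ (*-congˡ (dot-δ z a)))

    -- This is `(N I - J)² = N (N I - J)`: equal colours give `N² - N`, different ones `-N`.
    weights : ∀ a b → dot (weight a) (weight b) ≈ N * (N * δ a b) + - N
    weights a b = begin
      dot (weight a) (weight b)                          ≈⟨ dot-weight (weight a) b ⟩
      N * weight a b + - e * dot (weight a) ones         ≈⟨ +-congˡ (*-congˡ (trans (dot-comm (weight a) ones)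
                                                              (trans (dot-weight ones a) (+-congˡ (*-congˡ N≈))))) ⟩
      N * (N * δ a b + - e * e) + - e * (N * e + - e * N)
        ≈⟨ solve 2 (λ N d → N :* (N :* d :+ :- con 1ℚ :* con 1ℚ) :+ :- con 1ℚ :* (N :* con 1ℚ :+ :- con 1ℚ :* N)
                              := N :* (N :* d) :+ :- N) refl N (δ a b) ⟩
      N * (N * δ a b) + - N ∎
      where e = ⟦ 1ℚ ⟧

    A*δ≈0 : ∀ i j → A i j * δ (c i) (c j) ≈ 0#
    A*δ≈0 i j with c i Fin.≟ c j
    ... | yes cᵢ≡cⱼ = trans (*-identityʳ _) (proper i j cᵢ≡cⱼ)
    ... | no  _     = zeroʳ _

    y : Vector Carrier n → Fin g → Vector Carrier n
    y x d i = weight (c i) d * x i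

    weigh : ∀ z i j → sum (λ d → z * (weight (c i) d * weight (c j) d)) ≈ z * (N * (N * δ (c i) (c j)) + - N)
    weigh z i j = trans (sym (*-distribˡ-sum z (λ d → weight (c i) d * weight (c j) d))) (*-congˡ (weights (c i) (c j)))

    -- Pairs of equal colour are killed by `A`, and every other pair carries the same weight `-N`;
    -- so the sum is a multiple of the original form.
    sum-Q : ∀ x → sum (λ d → Q A (y x d)) ≈ - N * Q A x
    sum-Q x = begin
      sum (λ d → sum λ i → y x d i * apply A (y x d) i)
        ≈⟨ ∑-comm (λ d i → y x d i * apply A (y x d) i) ⟩
      sum (λ i → sum λ d → y x d i * apply A (y x d) i)
        ≈⟨ sum-cong-≋ row ⟩
      dot x (λ i → - N * apply A x i)
        ≈⟨ dot-scale x (- N) (apply A x) ⟩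
      - N * Q A x ∎
      where
      entry : ∀ i j → (x i * (A i j * x j)) * (N * (N * δ (c i) (c j)) + - N) ≈ x i * (- N * (A i j * x j))
      entry i j = begin
        (x i * (A i j * x j)) * (N * (N * δ (c i) (c j)) + - N)
          ≈⟨ solve 5 (λ x a z N d → (x :* (a :* z)) :* (N :* (N :* d) :+ :- N)
                        := x :* (:- N :* (a :* z)) :+ x :* z :* N :* N :* (a :* d))
               refl (x i) (A i j) (x j) N (δ (c i) (c j)) ⟩
        x i * (- N * (A i j * x j)) + x i * x j * N * N * (A i j * δ (c i) (c j))
          ≈⟨ +-congˡ (trans (*-congˡ (A*δ≈0 i j)) (zeroʳ _)) ⟩
        x i * (- N * (A i j * x j)) + 0#  ≈⟨ +-identityʳ _ ⟩
        x i * (- N * (A i j * x j)) ∎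

      row : ∀ i → sum (λ d → y x d i * apply A (y x d) i) ≈ x i * (- N * apply A x i)
      row i = begin
        sum (λ d → y x d i * apply A (y x d) i)
          ≈⟨ sum-cong-≋ (λ d → *-distribˡ-sum (y x d i) (λ j → A i j * y x d j)) ⟩
        sum (λ d → sum λ j → y x d i * (A i j * y x d j))
          ≈⟨ ∑-comm (λ d j → y x d i * (A i j * y x d j)) ⟩
        sum (λ j → sum λ d → y x d i * (A i j * y x d j))
          ≈⟨ sum-cong-≋ (λ j → trans (sum-cong-≋ (λ d →
               solve 5 (λ u v x a z → u :* x :* (a :* (v :* z)) := (x :* (a :* z)) :* (u :* v))
                 refl (weight (c i) d) (weight (c j) d) (x i) (A i j) (x j)))
               (trans (weigh (x i * (A i j * x j)) i j) (entry i j))) ⟩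
        sum (λ j → x i * (- N * (A i j * x j)))
          ≈⟨ *-distribˡ-sum (x i) (λ j → - N * (A i j * x j)) ⟨
        x i * sum (λ j → - N * (A i j * x j))
          ≈⟨ *-congˡ (*-distribˡ-sum (- N) (λ j → A i j * x j)) ⟨
        x i * (- N * apply A x i) ∎

    -- In contrast to `sum-Q`, only a vertex paired with itself occurs, so the weight is the one of
    -- equal colours.
    sum-norm² : ∀ x → sum (λ d → dot (y x d) (y x d)) ≈ (N * N + - N) * dot x x
    sum-norm² x = begin
      sum (λ d → sum λ i → y x d i * y x d i)  ≈⟨ ∑-comm (λ d i → y x d i * y x d i) ⟩
      sum (λ i → sum λ d → y x d i * y x d i)
        ≈⟨ sum-cong-≋ (λ i → trans (sum-cong-≋ (λ d →
             solve 2 (λ w x → w :* x :* (w :* x) := (x :* x) :* (w :* w)) refl (weight (c i) d) (x i)))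
             (trans (weigh (x i * x i) i i) (trans (*-congˡ (+-congʳ (*-congˡ (trans (*-congˡ (δ-same (c i))) (*-identityʳ N)))))
               (*-comm _ _)))) ⟩
      sum (λ i → (N * N + - N) * (x i * x i))  ≈⟨ *-distribˡ-sum (N * N + - N) (λ i → x i * x i) ⟨
      (N * N + - N) * dot x x ∎
      where
      δ-same : ∀ {m} (k : Fin m) → δ k k ≈ 1#
      δ-same k rewrite dec-true (k Fin.≟ k) ≡.refl = refl

    form-bound : Pos N → ∀ q → (∀ x → NonNeg (form A q x)) → ∀ x →
                 NonNeg ((q + - (N * q)) * dot x x + - Q A x)
    form-bound N>0 q f≥0 x = NonNeg-cancel N>0 (NonNeg-resp (begin
      sum (λ d → form A q (y x d))
        ≈⟨ ∑-distrib-+ (λ d → Q A (y x d)) (λ d → - q * dot (y x d) (y x d)) ⟩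
      sum (λ d → Q A (y x d)) + sum (λ d → - q * dot (y x d) (y x d))
        ≈⟨ +-cong (sum-Q x) (trans (sym (*-distribˡ-sum (- q) (λ d → dot (y x d) (y x d)))) (*-congˡ (sum-norm² x))) ⟩
      - N * Q A x + - q * ((N * N + - N) * dot x x)
        ≈⟨ solve 4 (λ N p q s → :- N :* p :+ :- q :* ((N :* N :+ :- N) :* s)
                      := N :* ((q :+ :- (N :* q)) :* s :+ :- p)) refl N (Q A x) q (dot x x) ⟩
      N * ((q + - (N * q)) * dot x x + - Q A x) ∎)
      (sum-nonNeg _ (λ d → f≥0 (y x d))))

    eigenvalue-bound : Pos N → ∀ q → (∀ x → NonNeg (form A q x)) →
                       ∀ p x → NonZero x → (∀ i → apply A x i ≈ p * x i) →
                       NonNeg ((q + - (N * q)) + - p)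
    eigenvalue-bound N>0 q f≥0 p x x≢0 eigen = NonNeg-intro (norm²-positive x x≢0 >>= λ s>0 →
      pure (NonNeg-cancel s>0 (NonNeg-resp (begin
        (q + - (N * q)) * dot x x + - Q A x
          ≈⟨ +-congˡ (-‿cong (trans (dot-congˡ x eigen) (dot-scale x p x))) ⟩
        (q + - (N * q)) * dot x x + - (p * dot x x)
          ≈⟨ solve 3 (λ r p s → r :* s :+ :- (p :* s) := s :* (r :+ :- p)) refl (q + - (N * q)) p (dot x x) ⟩
        dot x x * ((q + - (N * q)) + - p) ∎)
        (form-bound N>0 q f≥0 x))))

open ≡ using (refl; sym; trans; cong; cong₂; subst; subst₂)
open import Defs
open +-*-Solver using (solve; _:=_; _:+_; _:*_; _:-_; :-_; con)

-- The reals as an ordered algebra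

p≤q⇒0≤q-p : ∀ {p q} → p ℚ.≤ q → 0ℚ ℚ.≤ q ℚ.- p
p≤q⇒0≤q-p {p} {q} p≤q = subst (ℚ._≤ q ℚ.- p) (ℚ.+-inverseʳ p) (ℚ.+-monoˡ-≤ (ℚ.- p) p≤q)

p<q⇒0<q-p : ∀ {p q} → p ℚ.< q → 0ℚ ℚ.< q ℚ.- p
p<q⇒0<q-p {p} {q} p<q = subst (ℚ._< q ℚ.- p) (ℚ.+-inverseʳ p) (ℚ.+-monoˡ-< (ℚ.- p) p<q)

p+[q-p]≡q : ∀ p q → p ℚ.+ (q ℚ.- p) ≡ q
p+[q-p]≡q = solve 2 (λ p q → p :+ (q :- p) := q) refl

0≤q-p⇒p≤q : ∀ {p q} → 0ℚ ℚ.≤ q ℚ.- p → p ℚ.≤ q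
0≤q-p⇒p≤q {p} {q} h = subst₂ ℚ._≤_ (ℚ.+-identityʳ p) (p+[q-p]≡q p q) (ℚ.+-monoʳ-≤ p h)

0<q-p⇒p<q : ∀ {p q} → 0ℚ ℚ.< q ℚ.- p → p ℚ.< q
0<q-p⇒p<q {p} {q} h = subst₂ ℚ._<_ (ℚ.+-identityʳ p) (p+[q-p]≡q p q) (ℚ.+-monoʳ-< p h)

nonNeg-* : ∀ {p q} → 0ℚ ℚ.≤ p → 0ℚ ℚ.≤ q → 0ℚ ℚ.≤ p ℚ.* q
nonNeg-* {p} {q} 0≤p 0≤q = ℚ.nonNegative⁻¹ (p ℚ.* q)
  {{ℚ.nonNeg*nonNeg⇒nonNeg p {{ℚ.nonNegative 0≤p}} q {{ℚ.nonNegative 0≤q}}}}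

p≤∣p∣ : ∀ p → p ℚ.≤ abs p
p≤∣p∣ p with ℚ.≤-total 0ℚ p
... | inj₁ 0≤p = ℚ.≤-reflexive (sym (ℚ.0≤p⇒∣p∣≡p 0≤p))
... | inj₂ p≤0 = ℚ.≤-trans p≤0 (ℚ.0≤∣p∣ p)

∣p-q∣<ε⇒p-q<ε : ∀ p q {ε} → abs (p ℚ.- q) ℚ.< ε → p ℚ.- q ℚ.< ε
∣p-q∣<ε⇒p-q<ε p q h = ℚ.≤-<-trans (p≤∣p∣ (p ℚ.- q)) h

∣p-q∣≡∣q-p∣ : ∀ p q → abs (p ℚ.- q) ≡ abs (q ℚ.- p)
∣p-q∣≡∣q-p∣ p q = trans (sym (ℚ.∣-p∣≡∣p∣ (p ℚ.- q)))
  (cong abs (solve 2 (λ p q → :- (p :- q) := q :- p) refl p q))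

∣p∣<ε : ∀ {p ε} → p ℚ.< ε → ℚ.- p ℚ.< ε → abs p ℚ.< ε
∣p∣<ε {p} {ε} p<ε -p<ε with ℚ.∣p∣≡p∨∣p∣≡-p p
... | inj₁ eq = subst (ℚ._< ε) (sym eq) p<ε
... | inj₂ eq = subst (ℚ._< ε) (sym eq) -p<ε

ℚ-algebra : OrderedAlgebra Identity.Identity
ℚ-algebra = record
  { monad           = Identity.monad
  ; run             = λ x → x
  ; commutativeRing = ℚ.+-*-commutativeRing
  ; ι               = record
    { ⟦_⟧    = λ q → q
    ; +-homo = λ _ _ → refl
    ; *-homo = λ _ _ → refl
    ; -‿homo = λ _ → refl
    ; 0-homo = refl
    ; 1-homo = refl
    }
  ; Pos      = 0ℚ ℚ.<_
  ; Pos-resp = λ { refl 0<p → 0<p }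
  ; Pos-+    = ℚ.+-mono-<
  ; Pos-*    = pos-*
  ; Pos-1    = ℚ.positive⁻¹ 1ℚ
  ; ¬Pos-0   = ℚ.<-irrefl refl
  ; compare  = compare
  }
  where
  compare : ∀ p → 0ℚ ℚ.< p ⊎ p ≡ 0ℚ ⊎ 0ℚ ℚ.< ℚ.- p
  compare p with ℚ.<-cmp 0ℚ p
  ... | tri< 0<p _ _ = inj₁ 0<p
  ... | tri≈ _ 0≡p _ = inj₂ (inj₁ (sym 0≡p))
  ... | tri> _ _ p<0 = inj₂ (inj₂ (ℚ.neg-antimono-< p<0))

-- Equality of Cauchy sequences and the ring of reals.

≃-eventually : ∀ x y → (∃[ N ] ∀ n → N ℕ.≤ n → seq x n ≡ seq y n) → x ≃ y
≃-eventually x y (N , x≡y) ε 0<ε = N , λ n N≤n → subst (λ p → abs (p ℚ.- seq y n) ℚ.< ε) (sym (x≡y n N≤n))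
  (subst (ℚ._< ε) (sym (cong abs (ℚ.+-inverseʳ (seq y n)))) 0<ε)

≃-pointwise : ∀ x y → (∀ n → seq x n ≡ seq y n) → x ≃ y
≃-pointwise x y x≡y = ≃-eventually x y (0 , λ n _ → x≡y n)

≃-refl : ∀ {x} → x ≃ x
≃-refl {x} = ≃-pointwise x x (λ _ → refl)

≃-sym : ∀ {x y} → x ≃ y → y ≃ x
≃-sym {x} {y} x≃y ε 0<ε = let N , h = x≃y ε 0<ε in
  N , λ n N≤n → subst (ℚ._< ε) (∣p-q∣≡∣q-p∣ (seq x n) (seq y n)) (h n N≤n)

½ε+½ε≡ε : ∀ ε → ½ ℚ.* ε ℚ.+ ½ ℚ.* ε ≡ ε
½ε+½ε≡ε = solve 1 (λ ε → con ½ :* ε :+ con ½ :* ε := ε) refl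

0<½ε : ∀ {ε} → 0ℚ ℚ.< ε → 0ℚ ℚ.< ½ ℚ.* ε
0<½ε = pos-* (ℚ.positive⁻¹ ½)

+-close : ∀ p q {ε} → abs p ℚ.< ½ ℚ.* ε → abs q ℚ.< ½ ℚ.* ε → abs (p ℚ.+ q) ℚ.< ε
+-close p q {ε} p< q< = ℚ.≤-<-trans (ℚ.∣p+q∣≤∣p∣+∣q∣ p q)
  (subst (abs p ℚ.+ abs q ℚ.<_) (½ε+½ε≡ε ε) (ℚ.+-mono-< p< q<))

≃-trans : ∀ {x y z} → x ≃ y → y ≃ z → x ≃ z
≃-trans {x} {y} {z} x≃y y≃z ε 0<ε =
  let N₁ , h₁ = x≃y (½ ℚ.* ε) (0<½ε 0<ε)
      N₂ , h₂ = y≃z (½ ℚ.* ε) (0<½ε 0<ε)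
  in N₁ ℕ.⊔ N₂ , λ n N≤n → subst (λ d → abs d ℚ.< ε)
       (solve 3 (λ a b c → (a :- b) :+ (b :- c) := a :- c) refl (seq x n) (seq y n) (seq z n))
       (+-close (seq x n ℚ.- seq y n) (seq y n ℚ.- seq z n)
         (h₁ n (ℕ.m⊔n≤o⇒m≤o N₁ N₂ N≤n)) (h₂ n (ℕ.m⊔n≤o⇒n≤o N₁ N₂ N≤n)))

+-cong : ∀ {x y u v} → x ≃ y → u ≃ v → x + u ≃ y + v
+-cong {x} {y} {u} {v} x≃y u≃v ε 0<ε =
  let N₁ , h₁ = x≃y (½ ℚ.* ε) (0<½ε 0<ε)
      N₂ , h₂ = u≃v (½ ℚ.* ε) (0<½ε 0<ε)
  in N₁ ℕ.⊔ N₂ , λ n N≤n → subst (λ d → abs d ℚ.< ε)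
       (solve 4 (λ a b c d → (a :- b) :+ (c :- d) := (a :+ c) :- (b :+ d)) refl (seq x n) (seq y n) (seq u n) (seq v n))
       (+-close (seq x n ℚ.- seq y n) (seq u n ℚ.- seq v n)
         (h₁ n (ℕ.m⊔n≤o⇒m≤o N₁ N₂ N≤n)) (h₂ n (ℕ.m⊔n≤o⇒n≤o N₁ N₂ N≤n)))

-‿cong : ∀ {x y} → x ≃ y → - x ≃ - y
-‿cong {x} {y} x≃y ε 0<ε = let N , h = x≃y ε 0<ε in
  N , λ n N≤n → subst (ℚ._< ε) (trans (∣p-q∣≡∣q-p∣ (seq x n) (seq y n))
    (cong abs (solve 2 (λ p q → q :- p := :- p :- :- q) refl (seq x n) (seq y n)))) (h n N≤n)

*-cong : ∀ {x y u v} → x ≃ y → u ≃ v → x * u ≃ y * v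
*-cong {x} {y} {u} {v} x≃y u≃v ε 0<ε =
  let B , 0<B , N₁ , x≤B = bounded x
      C , 0<C , N₂ , v≤C = bounded v
      d , 0<d , [B+C]d≡ε = scale (B ℚ.+ C) ε (ℚ.+-mono-< 0<B 0<C) 0<ε
      N₃ , h₁ = x≃y d 0<d
      N₄ , h₂ = u≃v d 0<d
  in (N₁ ℕ.⊔ N₂) ℕ.⊔ (N₃ ℕ.⊔ N₄) , λ n N≤n →
    let N₁₂≤n = ℕ.m⊔n≤o⇒m≤o (N₁ ℕ.⊔ N₂) (N₃ ℕ.⊔ N₄) N≤n
        N₃₄≤n = ℕ.m⊔n≤o⇒n≤o (N₁ ℕ.⊔ N₂) (N₃ ℕ.⊔ N₄) N≤n
    in subst (abs (seq x n ℚ.* seq u n ℚ.- seq y n ℚ.* seq v n) ℚ.<_) [B+C]d≡ε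
      (product-close (seq x n) (seq u n) (seq y n) (seq v n) 0<B 0<C
        (x≤B n (ℕ.m⊔n≤o⇒m≤o N₁ N₂ N₁₂≤n)) (v≤C n (ℕ.m⊔n≤o⇒n≤o N₁ N₂ N₁₂≤n))
        (h₁ n (ℕ.m⊔n≤o⇒m≤o N₃ N₄ N₃₄≤n)) (h₂ n (ℕ.m⊔n≤o⇒n≤o N₃ N₄ N₃₄≤n)))

infix 4 _≋_

-- `_≃_` unfolds to a statement about sequences, from which unification cannot recover `x` and `y`;
-- a record keeps them visible.
record _≋_ (x y : ℝ) : Set where
  constructor ≋-intro
  field
    ≋-elim : x ≃ y
open _≋_ public

≋-pointwise : ∀ {x y} → (∀ n → seq x n ≡ seq y n) → x ≋ y
≋-pointwise {x} {y} x≡y = ≋-intro (≃-pointwise x y x≡y)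

infixl 6 _⊕_
infixl 7 _⊗_
infix  8 ⊖_

-- Opaque copies of the operations of ℝ: unfolding the originals down to ℚ
-- makes conversion checking of quadratic forms intractable.
opaque
  _⊕_ _⊗_ : ℝ → ℝ → ℝ
  x ⊕ y = x + y
  x ⊗ y = x * y

  ⊖_ : ℝ → ℝ
  ⊖ x = - x

opaque
  unfolding _⊕_ _⊗_ ⊖_

  seq-⊕ : ∀ x y k → seq (x ⊕ y) k ≡ seq x k ℚ.+ seq y k
  seq-⊕ x y k = refl

  seq-⊗ : ∀ x y k → seq (x ⊗ y) k ≡ seq x k ℚ.* seq y k
  seq-⊗ x y k = refl

  seq-⊖ : ∀ x k → seq (⊖ x) k ≡ ℚ.- seq x k
  seq-⊖ x k = refl

  ℝ-isCommutativeRing : IsCommutativeRing _≋_ _⊕_ _⊗_ ⊖_ 0ℝ 1ℝ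
  ℝ-isCommutativeRing = record
    { isRing = record
      { +-isAbelianGroup = record
        { isGroup = record
          { isMonoid = record
            { isSemigroup = record
              { isMagma = record
                { isEquivalence = record
                  { refl  = λ {x} → ≋-intro (≃-refl {x})
                  ; sym   = λ {x} {y} (≋-intro x≃y) → ≋-intro (≃-sym {x} {y} x≃y)
                  ; trans = λ {x} {y} {z} (≋-intro x≃y) (≋-intro y≃z) → ≋-intro (≃-trans {x} {y} {z} x≃y y≃z)
                  }
                ; ∙-cong = λ {x} {y} {u} {v} (≋-intro x≃y) (≋-intro u≃v) → ≋-intro (+-cong {x} {y} {u} {v} x≃y u≃v)
                }
              ; assoc = λ x y z → ≋-pointwise λ n → ℚ.+-assoc (seq x n) (seq y n) (seq z n)
              }
            ; identity = (λ x → ≋-pointwise λ n → ℚ.+-identityˡ (seq x n))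
                       , (λ x → ≋-pointwise λ n → ℚ.+-identityʳ (seq x n))
            }
          ; inverse = (λ x → ≋-pointwise λ n → ℚ.+-inverseˡ (seq x n))
                    , (λ x → ≋-pointwise λ n → ℚ.+-inverseʳ (seq x n))
          ; ⁻¹-cong = λ {x} {y} (≋-intro x≃y) → ≋-intro (-‿cong {x} {y} x≃y)
          }
        ; comm = λ x y → ≋-pointwise λ n → ℚ.+-comm (seq x n) (seq y n)
        }
      ; *-cong     = λ {x} {y} {u} {v} (≋-intro x≃y) (≋-intro u≃v) → ≋-intro (*-cong {x} {y} {u} {v} x≃y u≃v)
      ; *-assoc    = λ x y z → ≋-pointwise λ n → ℚ.*-assoc (seq x n) (seq y n) (seq z n)
      ; *-identity = (λ x → ≋-pointwise λ n → ℚ.*-identityˡ (seq x n))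
                   , (λ x → ≋-pointwise λ n → ℚ.*-identityʳ (seq x n))
      ; distrib    = (λ x y z → ≋-pointwise λ n → ℚ.*-distribˡ-+ (seq x n) (seq y n) (seq z n))
                   , (λ x y z → ≋-pointwise λ n → ℚ.*-distribʳ-+ (seq x n) (seq y n) (seq z n))
      }
    ; *-comm = λ x y → ≋-pointwise λ n → ℚ.*-comm (seq x n) (seq y n)
    }

ℝ-commutativeRing : CommutativeRing 0ℓ 0ℓ
ℝ-commutativeRing = record { isCommutativeRing = ℝ-isCommutativeRing }

-- Strict positivity.

record Positive (x : ℝ) : Set where
  constructor mkPositive
  field
    bound    : ℚ
    0<bound  : 0ℚ ℚ.< bound
    start    : ℕ
    bound≤   : ∀ n → start ℕ.≤ n → bound ℚ.≤ seq x n

Positive-resp : ∀ {x y} → x ≋ y → Positive x → Positive y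
Positive-resp {x} {y} (≋-intro x≃y) (mkPositive ε 0<ε N₁ ε≤x) =
  let N₂ , close = x≃y (½ ℚ.* ε) (0<½ε 0<ε)
  in mkPositive (½ ℚ.* ε) (0<½ε 0<ε) (N₁ ℕ.⊔ N₂) λ n N≤n → 0≤q-p⇒p≤q (subst (0ℚ ℚ.≤_)
       (solve 3 (λ ε x y → (x :- ε) :+ (con ½ :* ε :- (x :- y)) := y :- con ½ :* ε) refl ε (seq x n) (seq y n))
       (ℚ.+-mono-≤ (p≤q⇒0≤q-p (ε≤x n (ℕ.m⊔n≤o⇒m≤o N₁ N₂ N≤n)))
         (p≤q⇒0≤q-p (ℚ.<⇒≤ (∣p-q∣<ε⇒p-q<ε (seq x n) (seq y n) (close n (ℕ.m⊔n≤o⇒n≤o N₁ N₂ N≤n)))))))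

opaque
  unfolding _⊕_ _⊗_

  Positive-+ : ∀ {x y} → Positive x → Positive y → Positive (x ⊕ y)
  Positive-+ (mkPositive ε 0<ε N₁ ε≤x) (mkPositive η 0<η N₂ η≤y) =
    mkPositive (ε ℚ.+ η) (ℚ.+-mono-< 0<ε 0<η) (N₁ ℕ.⊔ N₂) λ n N≤n →
      ℚ.+-mono-≤ (ε≤x n (ℕ.m⊔n≤o⇒m≤o N₁ N₂ N≤n)) (η≤y n (ℕ.m⊔n≤o⇒n≤o N₁ N₂ N≤n))

  Positive-* : ∀ {x y} → Positive x → Positive y → Positive (x ⊗ y)
  Positive-* {x} {y} (mkPositive ε 0<ε N₁ ε≤x) (mkPositive η 0<η N₂ η≤y) =
    mkPositive (ε ℚ.* η) (pos-* 0<ε 0<η) (N₁ ℕ.⊔ N₂) λ n N≤n → 0≤q-p⇒p≤q (subst (0ℚ ℚ.≤_)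
      (solve 4 (λ ε η x y → (x :- ε) :* (y :- η) :+ ((x :- ε) :* η :+ ε :* (y :- η)) := x :* y :- ε :* η)
        refl ε η (seq x n) (seq y n))
      (let x-ε≥0 = p≤q⇒0≤q-p (ε≤x n (ℕ.m⊔n≤o⇒m≤o N₁ N₂ N≤n))
           y-η≥0 = p≤q⇒0≤q-p (η≤y n (ℕ.m⊔n≤o⇒n≤o N₁ N₂ N≤n))
       in ℚ.+-mono-≤ (nonNeg-* x-ε≥0 y-η≥0)
            (ℚ.+-mono-≤ (nonNeg-* x-ε≥0 (ℚ.<⇒≤ 0<η)) (nonNeg-* (ℚ.<⇒≤ 0<ε) y-η≥0))))

-- Cotransitivity of the order: past `N` the sequence stays within `ε/4` of its term at `N`, and
-- comparing that rational with `ε/2` is decidable.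
positive⊎small : ∀ x ε → 0ℚ ℚ.< ε → Positive x ⊎ ∃[ N ] ∀ n → N ℕ.≤ n → seq x n ℚ.< ε
positive⊎small x ε 0<ε with cauchy x (½ ℚ.* (½ ℚ.* ε)) (0<½ε (0<½ε 0<ε))
... | N , close with seq x N ℚ.≤? ½ ℚ.* ε
... | yes xN≤½ε = inj₂ (N , λ n N≤n → 0<q-p⇒p<q (subst (0ℚ ℚ.<_)
  (solve 3 (λ ε x y → (con ½ :* ε :- y) :+ (con ½ :* (con ½ :* ε) :- (x :- y)) :+ con ½ :* (con ½ :* ε) := ε :- x)
    refl ε (seq x n) (seq x N))
  (ℚ.+-mono-< (ℚ.+-mono-≤-< (p≤q⇒0≤q-p xN≤½ε)
    (p<q⇒0<q-p (∣p-q∣<ε⇒p-q<ε (seq x n) (seq x N) (close n N N≤n ℕ.≤-refl)))) (0<½ε (0<½ε 0<ε)))))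
... | no xN≰½ε = inj₁ (mkPositive (½ ℚ.* (½ ℚ.* ε)) (0<½ε (0<½ε 0<ε)) N λ n N≤n → 0≤q-p⇒p≤q (subst (0ℚ ℚ.≤_)
  (solve 3 (λ ε x y → (y :- con ½ :* ε) :+ (con ½ :* (con ½ :* ε) :- (y :- x)) := x :- con ½ :* (con ½ :* ε))
    refl ε (seq x n) (seq x N))
  (ℚ.<⇒≤ (ℚ.+-mono-< (p<q⇒0<q-p (ℚ.≰⇒> xN≰½ε))
    (p<q⇒0<q-p (∣p-q∣<ε⇒p-q<ε (seq x N) (seq x n) (close N n ℕ.≤-refl N≤n)))))))

-- Turns a negative statement into an explicit estimate; in this way facts known only as negations
-- still yield moduli.
¬Positive⇒small : ∀ x → ¬ Positive x → ∀ ε → 0ℚ ℚ.< ε → ∃[ N ] ∀ n → N ℕ.≤ n → seq x n ℚ.< ε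
¬Positive⇒small x x≯0 ε 0<ε with positive⊎small x ε 0<ε
... | inj₁ x>0   = ⊥-elim (x≯0 x>0)
... | inj₂ small = small

opaque
  unfolding ⊖_

  ≋0 : ∀ x → ¬ Positive x → ¬ Positive (⊖ x) → x ≋ 0ℝ
  ≋0 x x≯0 -x≯0 = ≋-intro λ ε 0<ε →
    let N₁ , x<ε  = ¬Positive⇒small x x≯0 ε 0<ε
        N₂ , -x<ε = ¬Positive⇒small (⊖ x) -x≯0 ε 0<ε
    in N₁ ℕ.⊔ N₂ , λ n N≤n → subst (λ p → abs p ℚ.< ε) (sym (ℚ.+-identityʳ (seq x n)))
         (∣p∣<ε (x<ε n (ℕ.m⊔n≤o⇒m≤o N₁ N₂ N≤n)) (-x<ε n (ℕ.m⊔n≤o⇒n≤o N₁ N₂ N≤n)))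

ι-homomorphism : ℚ.+-*-rawRing -Raw-AlmostCommutative⟶ fromCommutativeRing ℝ-commutativeRing
ι-homomorphism = record
  { ⟦_⟧    = fromℚ
  ; +-homo = λ p q → ≋-pointwise λ k → sym (seq-⊕ (fromℚ p) (fromℚ q) k)
  ; *-homo = λ p q → ≋-pointwise λ k → sym (seq-⊗ (fromℚ p) (fromℚ q) k)
  ; -‿homo = λ p → ≋-pointwise λ k → sym (seq-⊖ (fromℚ p) k)
  ; 0-homo = ≋-pointwise λ _ → refl
  ; 1-homo = ≋-pointwise λ _ → refl
  }

ℝ-algebra : OrderedAlgebra DoubleNegation
ℝ-algebra = record
  { monad           = ¬¬-Monad
  ; run             = λ ¬¬⊥ → ¬¬⊥ (λ x → x)
  ; commutativeRing = ℝ-commutativeRing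
  ; ι               = ι-homomorphism
  ; Pos      = Positive
  ; Pos-resp = Positive-resp
  ; Pos-+    = Positive-+
  ; Pos-*    = Positive-*
  ; Pos-1    = mkPositive 1ℚ (ℚ.positive⁻¹ 1ℚ) 0 λ _ _ → ℚ.≤-refl
  ; ¬Pos-0   = λ (mkPositive ε 0<ε N ε≤0) → ℚ.<-irrefl refl (ℚ.<-≤-trans 0<ε (ε≤0 N ℕ.≤-refl))
  -- If neither `x` nor its negative is positive, then `≋0` makes `x` zero; so the three cases
  -- cannot all fail.
  ; compare  = λ x undecided → undecided (inj₂ (inj₁ (≋0 x
      (λ x>0 → undecided (inj₁ x>0)) (λ x<0 → undecided (inj₂ (inj₂ x<0))))))
  }

module Qℚ = QuadraticForms ℚ-algebra
module Qℝ = QuadraticForms ℝ-algebra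
module Kℝ = OrderedAlgebra ℝ-algebra

-- The bottom of the spectrum of a symmetric rational matrix

natℚ : ℕ → ℚ
natℚ n = + n ℚ./ 1

-- `_/_` normalises by a gcd that is stuck on a variable `n`; the right-hand side exposes numerator
-- and denominator.
natℚ≡mkℚ : ∀ n → natℚ n ≡ mkℚ (+ n) 0 (Coprimality.sym (Coprimality.1-coprimeTo n))
natℚ≡mkℚ n = ℚ.↥p/↧p≡p (mkℚ (+ n) 0 (Coprimality.sym (Coprimality.1-coprimeTo n)))

natℚ-suc : ∀ n → natℚ (suc n) ≡ 1ℚ ℚ.+ natℚ n
natℚ-suc n = trans (cong (λ i → i ℚ./ 1) (sym (cong (λ i → + 1 ℤ.+ i) (ℤ.*-identityʳ (+ n)))))
  (cong (1ℚ ℚ.+_) (sym (natℚ≡mkℚ n)))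

0≤natℚ : ∀ n → 0ℚ ℚ.≤ natℚ n
0≤natℚ zero    = ℚ.≤-refl
0≤natℚ (suc n) = subst (0ℚ ℚ.≤_) (sym (natℚ-suc n)) (ℚ.+-mono-≤ (ℚ.<⇒≤ (ℚ.positive⁻¹ 1ℚ)) (0≤natℚ n))

natℚ-mono : ∀ {m n} → m ℕ.≤ n → natℚ m ℚ.≤ natℚ n
natℚ-mono {n = n} ℕ.z≤n = 0≤natℚ n
natℚ-mono {suc m} {suc n} (ℕ.s≤s m≤n) = subst₂ ℚ._≤_ (sym (natℚ-suc m)) (sym (natℚ-suc n))
  (ℚ.+-monoʳ-≤ 1ℚ (natℚ-mono m≤n))

q≤natℚ : ∀ q → ∃[ n ] q ℚ.≤ natℚ n
q≤natℚ q@(mkℚ a b _) = ℤ.∣ a ∣ , subst (q ℚ.≤_) (sym (natℚ≡mkℚ ℤ.∣ a ∣)) (ℚ.*≤* (begin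
  a ℤ.* + 1                ≡⟨ ℤ.*-identityʳ a ⟩
  a                        ≤⟨ i≤∣i∣ a ⟩
  + ℤ.∣ a ∣                ≤⟨ ℤ.+≤+ (ℕ.m≤m*n ℤ.∣ a ∣ (suc b)) ⟩
  + (ℤ.∣ a ∣ ℕ.* suc b)    ≡⟨ ℤ.pos-* ℤ.∣ a ∣ (suc b) ⟩
  + ℤ.∣ a ∣ ℤ.* + suc b    ∎))
  where
  open ℤ.≤-Reasoning
  i≤∣i∣ : ∀ i → i ℤ.≤ + ℤ.∣ i ∣
  i≤∣i∣ (+ n)        = ℤ.≤-refl
  i≤∣i∣ (ℤ.-[1+ n ]) = ℤ.-≤+

-- Halved widths tend to zero.

width : ℚ → ℕ → ℚ
width w zero    = w
width w (suc k) = ½ ℚ.* width w k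

0<width : ∀ {w} → 0ℚ ℚ.< w → ∀ k → 0ℚ ℚ.< width w k
0<width 0<w zero    = 0<w
0<width 0<w (suc k) = 0<½ε (0<width 0<w k)

-- This is `k + 1 ≤ 2ᵏ`, which reduces the convergence of the halving to the Archimedean property.
k*width≤w : ∀ {w} → 0ℚ ℚ.< w → ∀ k → natℚ (suc k) ℚ.* width w k ℚ.≤ w
k*width≤w {w} 0<w zero    = ℚ.≤-reflexive (ℚ.*-identityˡ w)
k*width≤w {w} 0<w (suc k) = 0≤q-p⇒p≤q (subst (0ℚ ℚ.≤_)
  (trans (solve 3 (λ n v w → (w :- (con 1ℚ :+ n) :* v) :+ con ½ :* (n :* v) := w :- (con 1ℚ :+ (con 1ℚ :+ n)) :* (con ½ :* v))
           refl (natℚ k) (width w k) w)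
         (cong (λ m → w ℚ.- m ℚ.* width w (suc k)) (sym (trans (natℚ-suc (suc k)) (cong (1ℚ ℚ.+_) (natℚ-suc k))))))
  (ℚ.+-mono-≤ (subst (λ m → 0ℚ ℚ.≤ w ℚ.- m ℚ.* width w k) (natℚ-suc k) (p≤q⇒0≤q-p (k*width≤w 0<w k)))
    (nonNeg-* (ℚ.nonNegative⁻¹ ½) (nonNeg-* (0≤natℚ k) (ℚ.<⇒≤ (0<width 0<w k))))))

width-small : ∀ {w} → 0ℚ ℚ.< w → ∀ ε → 0ℚ ℚ.< ε → ∃[ N ] ∀ k → N ℕ.≤ k → width w k ℚ.< ε
width-small {w} 0<w ε 0<ε with scale ε w 0<ε 0<w
... | r , _ , εr≡w with q≤natℚ r
... | N , r≤N = N , λ k N≤k → ℚ.*-cancelˡ-<-nonNeg (natℚ (suc k)) {{ℚ.nonNegative (0≤natℚ (suc k))}} (begin-strict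
  natℚ (suc k) ℚ.* width w k  ≤⟨ k*width≤w 0<w k ⟩
  w                           ≡⟨ εr≡w ⟨
  ε ℚ.* r                     ≤⟨ ℚ.*-monoˡ-≤-nonNeg ε {{ℚ.nonNegative (ℚ.<⇒≤ 0<ε)}} (ℚ.≤-trans r≤N (natℚ-mono N≤k)) ⟩
  ε ℚ.* natℚ k                ≡⟨ ℚ.*-comm ε (natℚ k) ⟩
  natℚ k ℚ.* ε                <⟨ ℚ.*-monoˡ-<-pos ε {{ℚ.positive 0<ε}}
                                   (subst (natℚ k ℚ.<_) (sym (natℚ-suc k)) (0<q-p⇒p<q (subst (0ℚ ℚ.<_)
                                     (solve 1 (λ n → con 1ℚ := (con 1ℚ :+ n) :- n) refl (natℚ k)) (ℚ.positive⁻¹ 1ℚ)))) ⟩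
  natℚ (suc k) ℚ.* ε          ∎)
  where open ℚ.≤-Reasoning

0≤⇒NonNegℚ : ∀ {p} → 0ℚ ℚ.≤ p → Qℚ.NonNeg p
0≤⇒NonNegℚ 0≤p 0<-p = ℚ.<-irrefl refl (ℚ.<-≤-trans 0<-p (ℚ.neg-antimono-≤ 0≤p))

NonNegℚ⇒0≤ : ∀ {p} → Qℚ.NonNeg p → 0ℚ ℚ.≤ p
NonNegℚ⇒0≤ {p} p≥0 = ℚ.≮⇒≥ (λ p<0 → p≥0 (ℚ.neg-antimono-< p<0))

-- Real forms computed term by term.

seq-sum : ∀ {n} (x : Vector ℝ n) k → seq (Qℝ.sum x) k ≡ Qℚ.sum (λ i → seq (x i) k)
seq-sum {zero}  x k = refl
seq-sum {suc n} x k = trans (seq-⊕ (x zero) (Qℝ.sum (x ∘ suc)) k) (cong (seq (x zero) k ℚ.+_) (seq-sum (x ∘ suc) k))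

seq-dot : ∀ {n} (x y : Vector ℝ n) k → seq (Qℝ.dot x y) k ≡ Qℚ.dot (λ i → seq (x i) k) (λ i → seq (y i) k)
seq-dot x y k = trans (seq-sum (λ i → x i ⊗ y i) k) (Qℚ.sum-cong-≋ (λ i → seq-⊗ (x i) (y i) k))

toℝ : ∀ {n} → Qℚ.SquareMatrix n → Matrix n
toℝ A i j = fromℚ (A i j)

-- The entries of `toℝ A` are constant sequences, so each term of the real form is the rational form
-- at the terms of `x`. Inequalities for rational vectors thus pass to real ones index by index.
seq-Q : ∀ {n} (A : Qℚ.SquareMatrix n) x k → seq (Qℝ.Q (toℝ A) x) k ≡ Qℚ.Q A (λ i → seq (x i) k)
seq-Q A x k = trans (seq-dot x (Qℝ.apply (toℝ A) x) k)
  (Qℚ.dot-congˡ (λ i → seq (x i) k) (λ i → seq-dot (toℝ A i) x k))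

seq-⊕⊗ : ∀ x y z k → seq (x ⊕ ⊖ y ⊗ z) k ≡ seq x k ℚ.+ ℚ.- seq y k ℚ.* seq z k
seq-⊕⊗ x y z k = trans (seq-⊕ x (⊖ y ⊗ z) k)
  (cong (seq x k ℚ.+_) (trans (seq-⊗ (⊖ y) z k) (cong (ℚ._* seq z k) (seq-⊖ y k))))

formℚ : ∀ {n} → Qℚ.SquareMatrix n → ℚ → Vector ℚ n → ℚ
formℚ A q x = Qℚ.Q A x ℚ.+ ℚ.- q ℚ.* Qℚ.dot x x

formℚ≡form : ∀ {n} (A : Qℚ.SquareMatrix n) q x → formℚ A q x ≡ Qℚ.form A q x
formℚ≡form A q x = refl

seq-form : ∀ {n} (A : Qℚ.SquareMatrix n) q x k →
           seq (Qℝ.form (toℝ A) q x) k ≡ formℚ A (seq q k) (λ i → seq (x i) k)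
seq-form A q x k = trans (seq-⊕⊗ (Qℝ.Q (toℝ A) x) q (Qℝ.dot x x) k)
  (cong₂ (λ p s → p ℚ.+ ℚ.- seq q k ℚ.* s) (seq-Q A x k) (seq-dot x x k))

seq-gap : ∀ {n} (A : Qℚ.SquareMatrix n) q c k x m →
          seq (Qℝ.gap (toℝ A) q c k x) m ≡
          seq k m ℚ.* formℚ A (seq q m) (λ i → seq (x i) m)
            ℚ.+ ℚ.- (seq c m ℚ.* Qℚ.dot (λ i → seq (x i) m) (λ i → seq (x i) m))
seq-gap A q c k x m = trans (seq-⊕ (k ⊗ Qℝ.form (toℝ A) q x) (⊖ (c ⊗ Qℝ.dot x x)) m)
  (cong₂ ℚ._+_
    (trans (seq-⊗ k (Qℝ.form (toℝ A) q x) m) (cong (seq k m ℚ.*_) (seq-form A q x m)))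
    (trans (seq-⊖ (c ⊗ Qℝ.dot x x) m) (cong ℚ.-_
      (trans (seq-⊗ c (Qℝ.dot x x) m) (cong (seq c m ℚ.*_) (seq-dot x x m))))))

NonNegℝ : ∀ x → (∀ k → 0ℚ ℚ.≤ seq x k) → Qℝ.NonNeg x
NonNegℝ x 0≤x (mkPositive ε 0<ε N ε≤-x) = ℚ.<-irrefl refl (ℚ.<-≤-trans 0<ε (ℚ.≤-trans (ε≤-x N ℕ.≤-refl)
  (subst (ℚ._≤ 0ℚ) (sym (seq-⊖ x N)) (ℚ.neg-antimono-≤ (0≤x N)))))

¬NonNegℝ : ∀ x b N → 0ℚ ℚ.< b → (∀ n → N ℕ.≤ n → b ℚ.≤ ℚ.- seq x n) → ¬ Qℝ.NonNeg x
¬NonNegℝ x b N 0<b b≤-x x≥0 = x≥0 (mkPositive b 0<b N λ n N≤n → subst (b ℚ.≤_) (sym (seq-⊖ x n)) (b≤-x n N≤n))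

seq-difference : ∀ x y k → seq (y ⊕ ⊖ x) k ≡ seq y k ℚ.- seq x k
seq-difference x y k = trans (seq-⊕ y (⊖ x) k) (cong (seq y k ℚ.+_) (seq-⊖ x k))

<⇒Positive : ∀ {x y} → x < y → Positive (y ⊕ ⊖ x)
<⇒Positive {x} {y} (ε , 0<ε , N , x+ε≤y) = mkPositive ε 0<ε N λ n N≤n →
  subst (ε ℚ.≤_) (sym (seq-difference x y n)) (0≤q-p⇒p≤q (subst (0ℚ ℚ.≤_)
    (solve 3 (λ x y ε → y :- (x :+ ε) := (y :- x) :- ε) refl (seq x n) (seq y n) ε) (p≤q⇒0≤q-p (x+ε≤y n N≤n))))

Positive⇒< : ∀ {x y} → Positive (y ⊕ ⊖ x) → x < y
Positive⇒< {x} {y} (mkPositive ε 0<ε N ε≤y-x) = ε , 0<ε , N , λ n N≤n → 0≤q-p⇒p≤q (subst (0ℚ ℚ.≤_)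
  (solve 3 (λ x y ε → (y :- x) :- ε := y :- (x :+ ε)) refl (seq x n) (seq y n) ε)
  (p≤q⇒0≤q-p (subst (ε ℚ.≤_) (seq-difference x y n) (ε≤y-x n N≤n))))

Positive⊎⇒# : ∀ {x} → Positive x ⊎ Positive (⊖ x) → x # 0ℝ
Positive⊎⇒# {x} (inj₁ x>0) = inj₂ (Positive⇒< {0ℝ} {x}
  (Positive-resp (≋-pointwise λ n → sym (trans (seq-difference 0ℝ x n) (ℚ.+-identityʳ (seq x n)))) x>0))
Positive⊎⇒# {x} (inj₂ x<0) = inj₁ (Positive⇒< {x} {0ℝ} (Positive-resp (Kℝ.sym (Kℝ.+-identityˡ (⊖ x))) x<0))

-- The form contributes at most `kf ≤ 2Bεs = ½ηs`, while `cs` is at least `ηs`; half of `ηs` remains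
-- as the amount by which definiteness fails.
definiteness-gap : ∀ c k f s {η B ε} → η ℚ.≤ c → abs k ℚ.≤ B → 0ℚ ℚ.≤ f → f ℚ.≤ (ε ℚ.+ ε) ℚ.* s →
                   0ℚ ℚ.≤ s → 0ℚ ℚ.≤ B → (B ℚ.+ B) ℚ.* ε ≡ ½ ℚ.* η →
                   ½ ℚ.* η ℚ.* s ℚ.≤ ℚ.- (k ℚ.* f ℚ.+ ℚ.- (c ℚ.* s))
definiteness-gap c k f s {η} {B} {ε} η≤c ∣k∣≤B 0≤f f≤2εs 0≤s 0≤B 2Bε≡½η = 0≤q-p⇒p≤q (subst (0ℚ ℚ.≤_)
  (trans (solve 7 (λ c k f s η B ε →
      (c :- η) :* s :+ ((B :- k) :* f :+ B :* ((ε :+ ε) :* s :- f))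
      := :- (k :* f :+ :- (c :* s)) :- (η :- (B :+ B) :* ε) :* s) refl c k f s η B ε)
    (trans (cong (λ t → ℚ.- (k ℚ.* f ℚ.+ ℚ.- (c ℚ.* s)) ℚ.- (η ℚ.- t) ℚ.* s) 2Bε≡½η)
      (solve 3 (λ q η s → q :- (η :- con ½ :* η) :* s := q :- con ½ :* η :* s)
        refl (ℚ.- (k ℚ.* f ℚ.+ ℚ.- (c ℚ.* s))) η s)))
  (ℚ.+-mono-≤ (nonNeg-* (p≤q⇒0≤q-p η≤c) 0≤s)
    (ℚ.+-mono-≤ (nonNeg-* (p≤q⇒0≤q-p (ℚ.≤-trans (p≤∣p∣ k) ∣k∣≤B)) 0≤f) (nonNeg-* 0≤B (p≤q⇒0≤q-p f≤2εs)))))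

seq-Defs-sum : ∀ {n} (x : Vector ℝ n) k → seq (sum x) k ≡ Qℚ.sum (λ i → seq (x i) k)
seq-Defs-sum {zero}  x k = refl
seq-Defs-sum {suc n} x k = cong (seq (x zero) k ℚ.+_) (seq-Defs-sum (x ∘ suc) k)

·≋apply : ∀ {n} (M : Matrix n) x i → (M · x) i ≋ Qℝ.apply M x i
·≋apply M x i = ≋-pointwise λ k →
  trans (seq-Defs-sum (λ j → M i j * x j) k) (sym (seq-dot (M i) x k))

*≋⊗ : ∀ x y → x * y ≋ x ⊗ y
*≋⊗ x y = ≋-pointwise λ k → sym (seq-⊗ x y k)

-- Bisection for the infimum of the Rayleigh quotient.

module BottomEigenvalue {n} (A : Qℚ.SquareMatrix n) (A-sym : Qℚ.Symmetric A) where

  Below Above : ℚ → Set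
  Below q = ∀ x → 0ℚ ℚ.≤ formℚ A q x
  Above q = ∃[ x ] formℚ A q x ℚ.< 0ℚ

  -- Over ℚ the monad is the identity, so `position` is a decision. A `q` that is itself the least
  -- eigenvalue counts as below.
  below⊎above : ∀ q → Below q ⊎ Above q
  below⊎above q with Qℚ.position A A-sym q
  ... | Qℚ.above x f<0       = inj₂ (x , ℚ.≰⇒> (λ f≥0 → 0≤⇒NonNegℚ (subst (0ℚ ℚ.≤_) (formℚ≡form A q x) f≥0) f<0))
  ... | Qℚ.bottom f≥0 _ _ _  = inj₁ λ x → subst (0ℚ ℚ.≤_) (sym (formℚ≡form A q x)) (NonNegℚ⇒0≤ (f≥0 x))
  ... | Qℚ.below f≥0 _ _ _ _ = inj₁ λ x → subst (0ℚ ℚ.≤_) (sym (formℚ≡form A q x)) (NonNegℚ⇒0≤ (f≥0 x))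

  0≤norm² : ∀ (x : Vector ℚ n) → 0ℚ ℚ.≤ Qℚ.dot x x
  0≤norm² x = NonNegℚ⇒0≤ (Qℚ.norm²-nonNeg x)

  below<above : ∀ l u → Below l → Above u → l ℚ.< u
  below<above l u l-below (x , u-above) = ℚ.≰⇒> λ u≤l → ℚ.<-irrefl refl (begin-strict
    0ℚ           ≤⟨ ℚ.+-mono-≤ (l-below x) (nonNeg-* (p≤q⇒0≤q-p u≤l) (0≤norm² x)) ⟩
    formℚ A l x ℚ.+ (l ℚ.- u) ℚ.* Qℚ.dot x x
                 ≡⟨ solve 4 (λ q l u s → (q :+ :- l :* s) :+ (l :- u) :* s := q :+ :- u :* s)
                      refl (Qℚ.Q A x) l u (Qℚ.dot x x) ⟩
    formℚ A u x  <⟨ u-above ⟩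
    0ℚ           ∎)
    where open ℚ.≤-Reasoning

  below-above-close : ∀ l m {v} → Below l → Above (m ℚ.+ v) → l ℚ.- m ℚ.< v
  below-above-close l m {v} l-below u-above = 0<q-p⇒p<q (subst (0ℚ ℚ.<_)
    (solve 3 (λ l m v → (m :+ v) :- l := v :- (l :- m)) refl l m v)
    (p<q⇒0<q-p (below<above l (m ℚ.+ v) l-below u-above)))

  record Bracket (w : ℚ) : Set where
    constructor bracket
    field
      lower : ℚ
      below : Below lower
      above : Above (lower ℚ.+ w)
  open Bracket

  halve : ∀ {w} → Bracket w → Bracket (½ ℚ.* w)
  halve {w} (bracket l l-below u-above) with below⊎above (l ℚ.+ ½ ℚ.* w)
  ... | inj₁ m-below = bracket (l ℚ.+ ½ ℚ.* w) m-below
    (subst Above (solve 2 (λ l w → l :+ w := l :+ con ½ :* w :+ con ½ :* w) refl l w) u-above)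
  ... | inj₂ m-above = bracket l l-below m-above

  brackets : ∀ {w} → Bracket w → ∀ k → Bracket (width w k)
  brackets b zero    = b
  brackets b (suc k) = halve (brackets b k)

  initial : ∀ u → Above u → ∃[ w ] 0ℚ ℚ.< w × Bracket w
  initial u u-above with Qℚ.Q-bounded-below A A-sym
  ... | c , _ , bound = u ℚ.- ℚ.- c , p<q⇒0<q-p (below<above (ℚ.- c) u -c-below u-above) ,
        bracket (ℚ.- c) -c-below (subst Above (sym (p+[q-p]≡q (ℚ.- c) u)) u-above)
    where
    -c-below : Below (ℚ.- c)
    -c-below x = subst (0ℚ ℚ.≤_)
      (solve 3 (λ q c s → q :+ c :* s := q :+ :- :- c :* s) refl (Qℚ.Q A x) c (Qℚ.dot x x)) (NonNegℚ⇒0≤ (bound x))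

  -- All that later arguments use of the bisection; they take a `Bottom` as a variable, so the
  -- construction of the brackets stays out of them.
  record Bottom : Set where
    field
      μ       : ℝ
      w       : ℚ
      0<w     : 0ℚ ℚ.< w
      μ-below : ∀ k → Below (seq μ k)
      μ-above : ∀ k → Above (seq μ k ℚ.+ width w k)

  bottom : ∀ u → Above u → Bottom
  bottom u u-above = let w , 0<w , b = initial u u-above in record
    { μ       = mkℝ (λ k → lower (brackets b k)) (lower-cauchy 0<w b)
    ; w       = w
    ; 0<w     = 0<w
    ; μ-below = λ k → below (brackets b k)
    ; μ-above = λ k → above (brackets b k)
    }
    where
    lower-cauchy : ∀ {w} → 0ℚ ℚ.< w → (b : Bracket w) → IsCauchy (λ k → lower (brackets b k))
    lower-cauchy {w} 0<w b ε 0<ε = let N , small = width-small 0<w ε 0<ε in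
      N , λ j k N≤j N≤k → ∣p∣<ε (ℚ.<-trans (close j k) (small k N≤k))
        (subst (ℚ._< ε) (solve 2 (λ l m → m :- l := :- (l :- m)) refl (l j) (l k))
          (ℚ.<-trans (close k j) (small j N≤j)))
      where
      l = λ k → lower (brackets b k)
      close : ∀ j k → l j ℚ.- l k ℚ.< width w k
      -- Lower ends lie below upper ends even across stages, so no monotonicity of the brackets
      -- enters.
      close j k = below-above-close (l j) (l k) (below (brackets b j)) (above (brackets b k))

  -- The limit of the bisection as an eigenvalue.

  module BottomProperties (B : Bottom) where
    open Bottom B

    formμ : Vector ℝ n → ℝ
    formμ = Qℝ.form (toℝ A) μ

    seq-formμ : ∀ x k → seq (formμ x) k ≡ formℚ A (seq μ k) (λ i → seq (x i) k)
    seq-formμ = seq-form A μ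

    formμ-nonNeg : ∀ x → Qℝ.NonNeg (formμ x)
    formμ-nonNeg x = NonNegℝ (formμ x) λ k →
      subst (0ℚ ℚ.≤_) (sym (seq-formμ x k)) (μ-below k (λ i → seq (x i) k))

    -- At the upper end of a narrow bracket there is a rational vector x for
    -- which the form is small compared with |x|².
    not-definite : ∀ c k → Positive c → ¬ (∀ x → Qℝ.NonNeg (Qℝ.gap (toℝ A) μ c k x))
    not-definite c k (mkPositive η 0<η N₁ η≤c) cs≤kf =
      let B , 0<B , N₂ , k≤B = bounded k
          -- Chosen so that the error `2Bεs` uses up exactly half of `ηs`.
          ε , 0<ε , 2Bε≡½η   = scale (B ℚ.+ B) (½ ℚ.* η) (ℚ.+-mono-< 0<B 0<B) (0<½ε 0<η)
          N₃ , small         = width-small 0<w ε 0<ε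
          x , g<0            = μ-above N₃
          v                  = width w N₃
          s                  = Qℚ.dot x x
          -- The forms at the two ends of the bracket differ by `v s` and have opposite signs, which
          -- makes `x` nonzero.
          0<vs = subst (0ℚ ℚ.<_)
            (solve 4 (λ q l v s → (q :+ :- l :* s) :- (q :+ :- (l :+ v) :* s) := v :* s) refl (Qℚ.Q A x) (seq μ N₃) v s)
            (p<q⇒0<q-p (ℚ.<-≤-trans g<0 (μ-below N₃ x)))
          0<s = ℚ.*-cancelˡ-<-nonNeg v {{ℚ.nonNegative (ℚ.<⇒≤ (0<width 0<w N₃))}}
            (subst (ℚ._< v ℚ.* s) (sym (ℚ.*-zeroʳ v)) 0<vs)
          -- One `ε` pays for the width of the bracket at `N₃`, the other for the drift of `μ` from
          -- index `N₃` to `m`.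
          f≤2εs : ∀ m → N₃ ℕ.≤ m → formℚ A (seq μ m) x ℚ.≤ (ε ℚ.+ ε) ℚ.* s
          f≤2εs m N₃≤m = 0≤q-p⇒p≤q (subst (0ℚ ℚ.≤_)
            (solve 6 (λ q l l′ v s ε →
                (con 0ℚ :- (q :+ :- (l :+ v) :* s)) :+ ((ε :- v) :* s :+ (ε :- (l :- l′)) :* s)
                := (ε :+ ε) :* s :- (q :+ :- l′ :* s))
              refl (Qℚ.Q A x) (seq μ N₃) (seq μ m) v s ε)
            (ℚ.+-mono-≤ (p≤q⇒0≤q-p (ℚ.<⇒≤ g<0)) (ℚ.+-mono-≤
              (nonNeg-* (p≤q⇒0≤q-p (ℚ.<⇒≤ (small N₃ ℕ.≤-refl))) (ℚ.<⇒≤ 0<s))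
              (nonNeg-* (p≤q⇒0≤q-p (ℚ.<⇒≤ (ℚ.<-trans (below-above-close (seq μ N₃) (seq μ m) (μ-below N₃) (μ-above m)) (small m N₃≤m)))) (ℚ.<⇒≤ 0<s)))))
          xℝ = λ i → fromℚ (x i)
      in ¬NonNegℝ (Qℝ.gap (toℝ A) μ c k xℝ) (½ ℚ.* η ℚ.* s) ((N₁ ℕ.⊔ N₂) ℕ.⊔ N₃) (pos-* (0<½ε 0<η) 0<s) (λ m N≤m →
        let N₁₂≤m = ℕ.m⊔n≤o⇒m≤o (N₁ ℕ.⊔ N₂) N₃ N≤m in
        subst (λ z → ½ ℚ.* η ℚ.* s ℚ.≤ ℚ.- z) (sym (seq-gap A μ c k xℝ m))
          (definiteness-gap (seq c m) (seq k m) (formℚ A (seq μ m) x) s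
            (η≤c m (ℕ.m⊔n≤o⇒m≤o N₁ N₂ N₁₂≤m)) (k≤B m (ℕ.m⊔n≤o⇒n≤o N₁ N₂ N₁₂≤m)) (μ-below m x)
            (f≤2εs m (ℕ.m⊔n≤o⇒n≤o (N₁ ℕ.⊔ N₂) N₃ N≤m)) (ℚ.<⇒≤ 0<s) (ℚ.<⇒≤ 0<B) 2Bε≡½η)) (cs≤kf xℝ)

    μ-eigenvalue : DoubleNegation (IsEigenvalue (toℝ A) μ)
    μ-eigenvalue ¬eigen = Qℝ.position (toℝ A) (λ i j → ≋-pointwise λ _ → A-sym i j) μ λ where
      (Qℝ.above x f<0)                → formμ-nonNeg x f<0
      (Qℝ.bottom _ x (i , xᵢ≢0) eigen) → ¬eigen (x , (i , Positive⊎⇒# {x i} xᵢ≢0) , λ j → ≋-elim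
        (Kℝ.trans (·≋apply (toℝ A) x j) (Kℝ.trans (eigen j) (Kℝ.sym (*≋⊗ μ (x j))))))
      (Qℝ.below _ c k c>0 cs≤kf)      → not-definite c k c>0 cs≤kf

-- Hypergraphs

member : ∀ {n} (e : Subset n) → 1 ℕ.≤ ∣ e ∣ → ∃[ i ] i ∈ e
member (inside  Vec.∷ e) _     = zero , Vec.here
member (outside Vec.∷ e) 1≤∣e∣ = let i , i∈e = member e 1≤∣e∣ in suc i , Vec.there i∈e

twoMembers : ∀ {n} (e : Subset n) → 2 ℕ.≤ ∣ e ∣ → ∃[ i ] ∃[ j ] i ≢ j × i ∈ e × j ∈ e
twoMembers (inside  Vec.∷ e) (ℕ.s≤s 1≤∣e∣) = let j , j∈e = member e 1≤∣e∣ in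
  zero , suc j , (λ ()) , Vec.here , Vec.there j∈e
twoMembers (outside Vec.∷ e) 2≤∣e∣ = let i , j , i≢j , i∈e , j∈e = twoMembers e 2≤∣e∣ in
  suc i , suc j , i≢j ∘ Fin.suc-injective , Vec.there i∈e , Vec.there j∈e

module _ {n : ℕ} where

  edgeWeight-pos : (e : Subset n) (2≤∣e∣ : 2 ℕ.≤ ∣ e ∣) → 0ℚ ℚ.< edgeWeight e 2≤∣e∣
  edgeWeight-pos e 2≤∣e∣ = ℚ.positive⁻¹ (edgeWeight e 2≤∣e∣)
    {{ℚ.normalize-pos 1 (∣ e ∣ ℕ.∸ 1) {{ℕ.>-nonZero (ℕ.m<n⇒0<n∸m 2≤∣e∣)}}}}

  edgeContribution-inside : ∀ i j e p → i ∈ e → j ∈ e → edgeContribution {n} i j e p ≡ edgeWeight e p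
  edgeContribution-inside i j e p i∈e j∈e with i ∈? e | j ∈? e
  ... | yes _  | yes _  = refl
  ... | no i∉e | _      = contradiction i∈e i∉e
  ... | yes _  | no j∉e = contradiction j∈e j∉e

  edgeContribution-outside : ∀ i j e p → ¬ (i ∈ e × j ∈ e) → edgeContribution {n} i j e p ≡ 0ℚ
  edgeContribution-outside i j e p ij∉e with i ∈? e | j ∈? e
  ... | yes i∈e | yes j∈e = contradiction (i∈e , j∈e) ij∉e
  ... | no _    | _       = refl
  ... | yes _   | no _    = refl

  edgeContribution-sym : ∀ i j e p → edgeContribution {n} i j e p ≡ edgeContribution j i e p
  edgeContribution-sym i j e p with i ∈? e | j ∈? e
  ... | yes _ | yes _ = refl
  ... | yes _ | no _  = refl
  ... | no _  | yes _ = refl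
  ... | no _  | no _  = refl

  edgeContribution-nonNeg : ∀ i j e p → 0ℚ ℚ.≤ edgeContribution {n} i j e p
  edgeContribution-nonNeg i j e p with i ∈? e | j ∈? e
  ... | yes _ | yes _ = ℚ.<⇒≤ (edgeWeight-pos e p)
  ... | yes _ | no _  = ℚ.≤-refl
  ... | no _  | _     = ℚ.≤-refl

  -- The off-diagonal value of `adjacencyEntry`, freed from the hypergraph so that induction over
  -- the edge list is possible.
  total : ∀ (i j : Fin n) {es} → All (λ e → 2 ℕ.≤ ∣ e ∣) es → ℚ
  total i j ps = foldr ℚ._+_ 0ℚ (reduce (λ {e} → edgeContribution i j e) ps)

  total-sym : ∀ i j {es} (ps : All _ es) → total i j ps ≡ total j i ps
  total-sym i j []                 = refl
  total-sym i j (All._∷_ {x = e} p ps) = cong₂ ℚ._+_ (edgeContribution-sym i j e p) (total-sym i j ps)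

  total-nonNeg : ∀ i j {es} (ps : All _ es) → 0ℚ ℚ.≤ total i j ps
  total-nonNeg i j []                 = ℚ.≤-refl
  total-nonNeg i j (All._∷_ {x = e} p ps) = ℚ.+-mono-≤ (edgeContribution-nonNeg i j e p) (total-nonNeg i j ps)

  total-zero : ∀ i j {es} (ps : All _ es) → ¬ Any (λ e → i ∈ e × j ∈ e) es → total i j ps ≡ 0ℚ
  total-zero i j []                 _  = refl
  total-zero i j (All._∷_ {x = e} p ps) ∉es = cong₂ ℚ._+_
    (edgeContribution-outside i j e p (∉es ∘ here)) (total-zero i j ps (∉es ∘ there))

  total-pos : ∀ {es} (ps : All (λ e → 2 ℕ.≤ ∣ e ∣) es) → es ≢ [] → ∃[ i ] ∃[ j ] i ≢ j × 0ℚ ℚ.< total i j ps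
  total-pos []                 []≢[] = contradiction refl []≢[]
  total-pos (All._∷_ {x = e} p ps) _     = let i , j , i≢j , i∈e , j∈e = twoMembers e p in
    i , j , i≢j , ℚ.+-mono-<-≤
      (subst (0ℚ ℚ.<_) (sym (edgeContribution-inside i j e p i∈e j∈e)) (edgeWeight-pos e p))
      (total-nonNeg i j ps)

module _ {n : ℕ} (G : Hypergraph n) where
  open Hypergraph G

  adjacencyEntry-diagonal : ∀ i → adjacencyEntry G i i ≡ 0ℚ
  adjacencyEntry-diagonal i with i Fin.≟ i
  ... | yes _  = refl
  ... | no i≢i = contradiction refl i≢i

  adjacencyEntry-distinct : ∀ {i j} → i ≢ j → adjacencyEntry G i j ≡ total i j size≥2
  adjacencyEntry-distinct {i} {j} i≢j with i Fin.≟ j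
  ... | yes i≡j = contradiction i≡j i≢j
  ... | no _    = refl

  adjacencyEntry-sym : ∀ i j → adjacencyEntry G i j ≡ adjacencyEntry G j i
  adjacencyEntry-sym i j with i Fin.≟ j | j Fin.≟ i
  ... | yes _   | yes _   = refl
  ... | yes i≡j | no j≢i  = contradiction (sym i≡j) j≢i
  ... | no i≢j  | yes j≡i = contradiction (sym j≡i) i≢j
  ... | no _    | no _    = total-sym i j size≥2

  adjacencyEntry-colouring : ∀ {k} (c : Fin n → Fin k) → IsStrongColoring G c →
                             ∀ i j → c i ≡ c j → adjacencyEntry G i j ≡ 0ℚ
  adjacencyEntry-colouring c proper i j cᵢ≡cⱼ with i Fin.≟ j
  ... | yes _  = refl
  ... | no i≢j = total-zero i j size≥2 (λ common → proper i j (i≢j , common) cᵢ≡cⱼ)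

-- Colour count, division and order in the reals.

seq-ones : ∀ g k → seq (Qℝ.dot (Qℝ.ones {g}) Qℝ.ones) k ≡ natℚ g
seq-ones g k = trans (seq-dot (Qℝ.ones {g}) Qℝ.ones k) (count g)
  where
  count : ∀ g → Qℚ.dot (λ (_ : Fin g) → 1ℚ) (λ _ → 1ℚ) ≡ natℚ g
  count zero    = refl
  count (suc g) = trans (cong (1ℚ ℚ.+_) (count g)) (sym (natℚ-suc g))

-- Since `recip` sends 0 to 0, the product of terms is known to be 1 only from the index on where
-- `x` stays away from zero.
inverse-⊗ : ∀ x (x#0 : x # 0ℝ) → inverse x x#0 ⊗ x ≋ 1ℝ
inverse-⊗ x x#0 = let d , 0<d , N , d≤∣x∣ = awayFromZero x x#0 in
  ≋-intro (≃-eventually (inverse x x#0 ⊗ x) 1ℝ (N , λ n N≤n →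
    trans (seq-⊗ (inverse x x#0) x n) (trans (ℚ.*-comm (recip (seq x n)) (seq x n))
      (recip-inverse (seq x n) λ xₙ≡0 → ℚ.<-irrefl refl (ℚ.<-≤-trans 0<d (subst (λ p → d ℚ.≤ abs p) xₙ≡0 (d≤∣x∣ n N≤n)))))))

#⇒Positive⊎ : ∀ x → x # 0ℝ → Positive x ⊎ Positive (⊖ x)
#⇒Positive⊎ x (inj₁ x<0) = inj₂ (Positive-resp (Kℝ.+-identityˡ (⊖ x)) (<⇒Positive {x} {0ℝ} x<0))
#⇒Positive⊎ x (inj₂ x>0) = inj₁ (Positive-resp
  (≋-pointwise λ n → trans (seq-difference 0ℝ x n) (ℚ.+-identityʳ (seq x n))) (<⇒Positive {0ℝ} {x} x>0))

≤⇒NonNeg : ∀ x y → x ≤ y → Qℝ.NonNeg (y ⊕ ⊖ x)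
≤⇒NonNeg x y x≤y y-x<0 = x≤y (Positive⇒< {y} {x} (Positive-resp
  (Qℝ.neg-difference x y) y-x<0))

-- The Rayleigh quotient of `eᵢ - eⱼ` is `-Aᵢⱼ`. The threshold is put halfway between it and 0,
-- which leaves a strict gap on either side: one for `Above`, one for the sign of `λmin`.
above-difference : ∀ {n} (A : Qℚ.SquareMatrix n) (A-sym : Qℚ.Symmetric A) {i j} → i ≢ j →
                   A i i ≡ 0ℚ → A j j ≡ 0ℚ → 0ℚ ℚ.< A i j →
                   BottomEigenvalue.Above A A-sym (ℚ.- (½ ℚ.* A i j))
above-difference A A-sym {i} {j} i≢j Aii≡0 Ajj≡0 0<a = Qℚ.difference i j , subst (ℚ._< 0ℚ)
  (sym (trans (formℚ≡form A u (Qℚ.difference i j)) (trans (Qℚ.form-difference A A-sym i≢j Aii≡0 Ajj≡0 u) (value (A i j)))))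
  (ℚ.neg-antimono-< 0<a)
  where
  u : ℚ
  u = ℚ.- (½ ℚ.* A i j)
  value : ∀ a → ℚ.- (a ℚ.+ a) ℚ.+ ℚ.- (ℚ.- (½ ℚ.* a)) ℚ.* (1ℚ ℚ.+ 1ℚ) ≡ ℚ.- a
  value = solve 1 (λ a → :- (a :+ a) :+ :- (:- (con ½ :* a)) :* (con 1ℚ :+ con 1ℚ) := :- a) refl

quotient-bound : ∀ N p q (q#0 : q # 0ℝ) → Positive (⊖ q) →
                 Qℝ.NonNeg ((q ⊕ ⊖ (N ⊗ q)) ⊕ ⊖ p) → N ≥ 1ℝ - divide p q q#0
quotient-bound N p q q#0 q<0 h N<z = h (Positive-resp
    (Kℝ.trans (Kℝ.*-congʳ (Kℝ.+-congʳ quotient)) (Qℝ.quotient-identity N p (inverse-⊗ q q#0)))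
    (Positive-* (<⇒Positive {N} {1ℝ - divide p q q#0} N<z) q<0))
  where
  quotient : 1ℝ - divide p q q#0 ≋ 1ℝ ⊕ ⊖ (p ⊗ inverse q q#0)
  quotient = ≋-pointwise λ k → sym (trans (seq-difference (p ⊗ inverse q q#0) 1ℝ k)
    (cong (λ r → 1ℚ ℚ.- r) (seq-⊗ p (inverse q q#0) k)))

-- The bound for a symmetric rational matrix.

module Spectrum {n} (A : Qℚ.SquareMatrix n) (A-sym : Qℚ.Symmetric A) (a : ℚ) (0<a : 0ℚ ℚ.< a) where
  open BottomEigenvalue A A-sym

  module _ (B : Bottom) (u-above : Above (ℚ.- (½ ℚ.* a)))
           (λmin : ℝ) (smallest : ∀ ν → IsEigenvalue (toℝ A) ν → λmin ≤ ν) where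
    open Bottom B
    open BottomProperties B

    λmin≤μ : Qℝ.NonNeg (μ ⊕ ⊖ λmin)
    λmin≤μ = ≤⇒NonNeg λmin μ λ μ<λmin → μ-eigenvalue λ eigen → smallest μ eigen μ<λmin

    λmin-form : ∀ x → Qℝ.NonNeg (Qℝ.form (toℝ A) λmin x)
    λmin-form x = Qℝ.form-antitone (toℝ A) λmin≤μ x (formμ-nonNeg x)

    -- Since `λmin ≤ μ` is only a negation, it is used up to an error of `a/4`; of the margin `a/2`
    -- by which `μ` lies below 0, the other `a/4` remains as the bound.
    λmin<0 : Positive (⊖ λmin)
    λmin<0 = let N , small = ¬Positive⇒small (⊖ (μ ⊕ ⊖ λmin)) λmin≤μ ¼a 0<¼a in
      mkPositive ¼a 0<¼a N λ k N≤k → 0≤q-p⇒p≤q (subst (0ℚ ℚ.≤_)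
        (trans (arithmetic (seq μ k) (seq λmin k)) (cong (λ p → p ℚ.- ¼a) (sym (seq-⊖ λmin k))))
        (ℚ.<⇒≤ (ℚ.+-mono-< (p<q⇒0<q-p (below<above (seq μ k) (ℚ.- (½ ℚ.* a)) (μ-below k) u-above))
          (p<q⇒0<q-p (subst (ℚ._< ¼a)
            (trans (seq-⊖ (μ ⊕ ⊖ λmin) k) (cong ℚ.-_ (seq-difference λmin μ k))) (small k N≤k))))))
      where
      ¼a = ½ ℚ.* (½ ℚ.* a)
      0<¼a = 0<½ε (0<½ε 0<a)
      arithmetic : ∀ m l → (ℚ.- (½ ℚ.* a) ℚ.- m) ℚ.+ (¼a ℚ.- ℚ.- (m ℚ.- l)) ≡ ℚ.- l ℚ.- ¼a
      arithmetic = solve 3 (λ a m l → (:- (con ½ :* a) :- m) :+ (con ½ :* (con ½ :* a) :- :- (m :- l))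
                              := :- l :- con ½ :* (con ½ :* a)) refl a

    coloured-bound : ∀ {γ} (c : Fin n → Fin γ) → (∀ i j → c i ≡ c j → A i j ≡ 0ℚ) →
                     ∀ λmax → IsEigenvalue (toℝ A) λmax →
                     Qℝ.NonNeg ((λmin ⊕ ⊖ (fromℕ γ ⊗ λmin)) ⊕ ⊖ λmax)
    coloured-bound {γ} c proper λmax (x , (i₀ , xᵢ#0) , x-eigen) =
      eigenvalue-bound N>0 λmin λmin-form λmax x (i₀ , #⇒Positive⊎ (x i₀) xᵢ#0) λ i →
        Kℝ.trans (Kℝ.sym (·≋apply (toℝ A) x i)) (Kℝ.trans (≋-intro (x-eigen i)) (*≋⊗ λmax (x i)))
      where
      open Qℝ.Hoffman (toℝ A) c (λ i j cᵢ≡cⱼ → ≋-pointwise λ _ → proper i j cᵢ≡cⱼ)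
        (fromℕ γ) (≋-pointwise (seq-ones γ))
      0<natℚ : ∀ {g} → Fin g → 0ℚ ℚ.< natℚ g
      0<natℚ {suc g} _ = subst (0ℚ ℚ.<_) (sym (natℚ-suc g)) (ℚ.+-mono-<-≤ (ℚ.positive⁻¹ 1ℚ) (0≤natℚ g))
      N>0 : Positive (fromℕ γ)
      -- The eigenvector has a nonzero coordinate `i₀`, and the colour of that vertex shows that
      -- there is at least one colour.
      N>0 = mkPositive (natℚ γ) (0<natℚ (c i₀)) 0 λ _ _ → ℚ.≤-refl

    spectral-bound : ∀ {γ} (c : Fin n → Fin γ) → (∀ i j → c i ≡ c j → A i j ≡ 0ℚ) →
                     ∀ λmax → IsEigenvalue (toℝ A) λmax →
                     Σ[ λmin#0 ∈ λmin # 0ℝ ] fromℕ γ ≥ 1ℝ - divide λmax λmin λmin#0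
    spectral-bound {γ} c proper λmax eigen = λmin#0 ,
      quotient-bound (fromℕ γ) λmax λmin λmin#0 λmin<0 (coloured-bound c proper λmax eigen)
      where
      λmin#0 : λmin # 0ℝ
      λmin#0 = Positive⊎⇒# {λmin} (inj₂ λmin<0)

matrix-bound : ∀ {n} (A : Qℚ.SquareMatrix n) → Qℚ.Symmetric A → (∀ i → A i i ≡ 0ℚ) →
               (∃[ i ] ∃[ j ] i ≢ j × 0ℚ ℚ.< A i j) →
               ∀ {γ} (c : Fin n → Fin γ) → (∀ i j → c i ≡ c j → A i j ≡ 0ℚ) →
               ∀ λmax λmin → IsEigenvalue (toℝ A) λmax → (∀ ν → IsEigenvalue (toℝ A) ν → λmin ≤ ν) →
               Σ[ λmin#0 ∈ λmin # 0ℝ ] fromℕ γ ≥ 1ℝ - divide λmax λmin λmin#0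
matrix-bound A A-sym diagonal (i , j , i≢j , 0<a) c proper λmax λmin eigen smallest =
  Spectrum.spectral-bound A A-sym (A i j) 0<a (BottomEigenvalue.bottom A A-sym (ℚ.- (½ ℚ.* A i j)) u-above) u-above λmin smallest
    c proper λmax eigen
  where
  u-above : BottomEigenvalue.Above A A-sym (ℚ.- (½ ℚ.* A i j))
  u-above = above-difference A A-sym i≢j (diagonal i) (diagonal j) 0<a

adjacencyEntry-edge : ∀ {n} (G : Hypergraph n) → HasEdge G → ∃[ i ] ∃[ j ] i ≢ j × 0ℚ ℚ.< adjacencyEntry G i j
adjacencyEntry-edge G hasEdge = let i , j , i≢j , 0<total = total-pos (Hypergraph.size≥2 G) hasEdge in
  i , j , i≢j , subst (0ℚ ℚ.<_) (sym (adjacencyEntry-distinct G i≢j)) 0<total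

-- Left to conversion under IsEigenvalue, this equality is not checked in
-- reasonable time; hence the explicit transport in theorem4.
adjacencyMatrix≡toℝ : ∀ {n} (G : Hypergraph n) → adjacencyMatrix G ≡ toℝ (adjacencyEntry G)
adjacencyMatrix≡toℝ G = refl

theorem4 : ∀ (n : ℕ) (G : Hypergraph n) → HasEdge G →
    ∀ (γ : ℕ) → IsStrongChromaticNumber G γ →
    ∀ (λmax λmin : ℝ) →
    IsLargestEigenvalue (adjacencyMatrix G) λmax →
    IsSmallestEigenvalue (adjacencyMatrix G) λmin →
    Σ[ λmin#0 ∈ λmin # 0ℝ ]
    fromℕ γ ≥ 1ℝ - divide λmax λmin λmin#0
theorem4 n G hasEdge γ ((c , c-proper) , _) λmax λmin (λmax-eigen , _) (_ , λmin-smallest) =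
  matrix-bound (adjacencyEntry G) (adjacencyEntry-sym G) (adjacencyEntry-diagonal G) (adjacencyEntry-edge G hasEdge)
    c (adjacencyEntry-colouring G c c-proper) λmax λmin
    (subst (λ M → IsEigenvalue M λmax) (adjacencyMatrix≡toℝ G) λmax-eigen)
    (λ ν ν-eigen → λmin-smallest ν (subst (λ M → IsEigenvalue M ν) (sym (adjacencyMatrix≡toℝ G)) ν-eigen))
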